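{- Let $A=\mathbb{F}_q[t]$, where $q$ is a power of an odd prime $p$. Let $\wp\in A$ be a monic irreducible polynomial of degree $d$, and let $\theta\in\mathbb{F}_{q^d}$ be a root of $\wp$. Write $\wp'=d\wp/dt$. Then each of the following conditions is equivalent to $\wp$ being a Wilson prime, i.e. to $F_d\equiv -1\pmod{\wp^2}$ (equivalently, to $d^2\wp/dt^2=0$): (i-ii) $dQ_{\wp}(t)/dt\equiv 0\pmod{\wp}$; (i-ii') $(dQ_{\wp}(t)/dt)|_{t=\theta}=0$; (ii-i) $Q_{\wp}(\wp')\equiv 0\pmod{\wp}$; (ii-i') $Q_{\wp}(\wp')|_{t=\theta}=0$; (i-iii) $(d\wp^{[1]}/dt)|_{t=\theta}=0$; (iii-i) $(\wp')^{[1]}|_{t=\theta}=0$; (ii-iii) $Q_{\wp}(\wp^{[1]})|_{t=\theta}=0$; (iii-ii) $(Q_{\wp}(t))^{[1]}|_{t=\theta}=0$.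
   Context: $F_d$ denotes the product of all nonzero polynomials in $A$ of degree less than $d$. For $a\in\mathbb{F}_{q^d}[t]$, the Fermat quotient is $Q_{\wp}(a):=(a^{q^d}-a)/\wp\in\mathbb{F}_{q^d}[t]$ (a polynomial since $\wp\mid t^{q^d}-t$), and the difference quotient is $a^{[1]}(t):=(a(t)-a(\theta))/(t-\theta)\in\mathbb{F}_{q^d}[t]$. Congruences modulo $\wp$ are divisibility in $\mathbb{F}_{q^d}[t]$. -}

module Defs where

open import Level using (0ℓ)
open import Algebra.Bundles using (CommutativeRing)
open import Algebra.Morphism.Structures using (module RingMorphisms)
open import Data.Nat as ℕ using (ℕ; zero; suc)
open import Data.Fin as Fin using (Fin)
open import Data.Bool using (Bool; true; false; if_then_else_)
open import Data.List as List using (List; []; _∷_)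
open import Data.List.Relation.Unary.All using (All)
open import Data.Vec as Vec using (Vec)
open import Data.Product using (Σ; ∃; _×_; _,_; proj₁; proj₂)
open import Relation.Nullary using (¬_)
open import Relation.Nullary.Decidable using (⌊_⌋)
open import Relation.Binary.PropositionalEquality using (_≡_)

IsField : CommutativeRing 0ℓ 0ℓ → Set
IsField R = (¬ (1# ≈ 0#)) × (∀ x → ¬ (x ≈ 0#) → ∃ λ y → x * y ≈ 1#)
  where open CommutativeRing R

record HasSize (R : CommutativeRing 0ℓ 0ℓ) (n : ℕ) : Set where
  open CommutativeRing R
  field
    enum  : Fin n → Carrier
    inj   : ∀ i j → enum i ≈ enum j → i ≡ j
    surj  : ∀ x → ∃ λ i → enum i ≈ x

IsRingHom : (F K : CommutativeRing 0ℓ 0ℓ) →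
            (CommutativeRing.Carrier F → CommutativeRing.Carrier K) → Set
IsRingHom F K f = RingMorphisms.IsRingHomomorphism
                    (CommutativeRing.rawRing F) (CommutativeRing.rawRing K) f

-- Polynomials over a commutative ring R in one variable t,
-- as coefficient lists, lowest degree first (trailing zeros allowed).

module Poly (R : CommutativeRing 0ℓ 0ℓ) where
  open CommutativeRing R

  P : Set
  P = List Carrier

  infixl 6 _+P_ _-P_
  infixl 7 _*P_ _·P_
  infix  4 _≈P_ _∣P_

  _+P_ : P → P → P
  []       +P b        = b
  (a ∷ as) +P []       = a ∷ as
  (a ∷ as) +P (b ∷ bs) = (a + b) ∷ (as +P bs)

  -P_ : P → P
  -P a = List.map -_ a

  _-P_ : P → P → P
  a -P b = a +P (-P b)

  _·P_ : Carrier → P → P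
  c ·P a = List.map (c *_) a

  _*P_ : P → P → P
  []       *P b = []
  (c ∷ as) *P b = (c ·P b) +P (0# ∷ (as *P b))

  constP : Carrier → P
  constP c = c ∷ []

  oneP : P
  oneP = constP 1#

  X : P
  X = 0# ∷ 1# ∷ []

  _^P_ : P → ℕ → P
  a ^P zero  = oneP
  a ^P suc n = a *P (a ^P n)

  deriv : P → P
  deriv []       = []
  deriv (c ∷ as) = as +P (0# ∷ deriv as)

  eval : P → Carrier → Carrier
  eval []       x = 0#
  eval (c ∷ as) x = c + x * eval as x

  IsZeroP : P → Set
  IsZeroP a = All (_≈ 0#) a

  _≈P_ : P → P → Set
  a ≈P b = IsZeroP (a -P b)

  _∣P_ : P → P → Set
  m ∣P a = ∃ λ c → a ≈P m *P c

  _≡P_[mod_] : P → P → P → Set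
  a ≡P b [mod m ] = m ∣P (a -P b)

  -- difference quotient a^[1](t) = (a(t) - a(θ)) / (t - θ),
  -- computed by  (c + t a)^[1] = a(θ) + t a^[1]
  diffQuot : Carrier → P → P
  diffQuot θ []       = []
  diffQuot θ (c ∷ as) = eval as θ ∷ diffQuot θ as

  -- long division by a monic polynomial g = gs + t^m, where gs are the
  -- m low coefficients (g's last coefficient is assumed to be 1)
  private
    initLast : Carrier → List Carrier → List Carrier × Carrier
    initLast c []       = [] , c
    initLast c (x ∷ xs) with initLast x xs
    ... | i , l = (c ∷ i) , l

  lowCoeffs : P → List Carrier
  lowCoeffs []       = []
  lowCoeffs (x ∷ xs) = proj₁ (initLast x xs)

  -- returns (quotient , remainder); the remainder has length m
  divModMonic : List Carrier → P → P × List Carrier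
  divModMonic gs []       = [] , List.replicate (List.length gs) 0#
  divModMonic gs (c ∷ as) with divModMonic gs as
  ... | q' , r with initLast c r
  ...   | low , l = (l ∷ q') , List.zipWith (λ u g → u - l * g) low gs

  quotMonic : P → P → P
  quotMonic a g = proj₁ (divModMonic (lowCoeffs g) a)

  MonicOfDegree : P → ℕ → Set
  MonicOfDegree g d = (List.length g ≡ suc d) × (List.last g ≡ Data.Maybe.just 1#)
    where import Data.Maybe

  IsUnitP : P → Set
  IsUnitP a = ∃ λ b → a *P b ≈P oneP

  Irreducible : P → Set
  Irreducible g = (¬ IsUnitP g) ×
    (∀ a b → g ≈P a *P b → IsUnitP a Data.Sum.⊎ IsUnitP b)
    where import Data.Sum

allVecs : (q d : ℕ) → List (Vec (Fin q) d)
allVecs q zero    = Vec.[] ∷ []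
allVecs q (suc d) = List.concatMap (λ i → List.map (i Vec.∷_) (allVecs q d))
                                   (List.allFin q)

module _ (F : CommutativeRing 0ℓ 0ℓ) {q : ℕ} (S : HasSize F q) where
  open CommutativeRing F
  open Poly F
  open HasSize S

  -- index of 0 in the enumeration; a coefficient vector is the zero
  -- polynomial iff all its indices equal it (enum is a bijection)
  private
    i₀ : Fin q
    i₀ = proj₁ (surj 0#)

    isZeroVec : ∀ {d} → Vec (Fin q) d → Bool
    isZeroVec c = Vec.foldr _ (λ i b → if ⌊ i Fin.≟ i₀ ⌋ then b else false) true c

    toPoly : ∀ {d} → Vec (Fin q) d → P
    toPoly c = Vec.toList (Vec.map enum c)

  Fprod : ℕ → P
  Fprod d = List.foldr (λ c acc → if isZeroVec c then acc else toPoly c *P acc)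
                       oneP (allVecs q d)

  IsWilsonPrime : P → ℕ → Set
  IsWilsonPrime ℘ d = Fprod d ≡P (-P oneP) [mod ℘ *P ℘ ]

-- The objects of the theorem, for F = F_q, K = F_{q^d}, ι : F → K,
-- ℘ ∈ A = F[t] and θ ∈ K.

module WilsonSetup (F K : CommutativeRing 0ℓ 0ℓ)
                   (ι : CommutativeRing.Carrier F → CommutativeRing.Carrier K)
                   (q d : ℕ) (℘ : Poly.P F) where
  private
    module PF = Poly F
  open Poly K public

  ιP : PF.P → P
  ιP = List.map ι

  ℘K : P
  ℘K = ιP ℘

  ℘′ : P
  ℘′ = ιP (PF.deriv ℘)

  Qf : P → P
  Qf a = quotMonic ((a ^P (q ℕ.^ d)) -P a) ℘K

  module _ (θ : CommutativeRing.Carrier K) where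
    open CommutativeRing K using (_≈_; 0#)

    IsRoot : Set
    IsRoot = eval ℘K θ ≈ 0#

    cond-i-ii : Set
    cond-i-ii = deriv (Qf X) ≡P [] [mod ℘K ]

    cond-i-ii′ : Set
    cond-i-ii′ = eval (deriv (Qf X)) θ ≈ 0#

    cond-ii-i : Set
    cond-ii-i = Qf ℘′ ≡P [] [mod ℘K ]

    cond-ii-i′ : Set
    cond-ii-i′ = eval (Qf ℘′) θ ≈ 0#

    cond-i-iii : Set
    cond-i-iii = eval (deriv (diffQuot θ ℘K)) θ ≈ 0#

    cond-iii-i : Set
    cond-iii-i = eval (diffQuot θ ℘′) θ ≈ 0#

    cond-ii-iii : Set
    cond-ii-iii = eval (Qf (diffQuot θ ℘K)) θ ≈ 0#

    cond-iii-ii : Set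
    cond-iii-ii = eval (diffQuot θ (Qf X)) θ ≈ 0#

{-# OPTIONS --safe #-}
module Submission where

open import Defs
open import Level using (0ℓ)
open import Algebra.Bundles using (CommutativeMonoid; CommutativeRing)
open import Algebra.Morphism.Structures using (module RingMorphisms)
import Algebra.Properties.CommutativeMonoid.Sum as MonoidSum
import Algebra.Properties.CommutativeSemigroup as SemigroupProperties
import Algebra.Properties.Ring as RingProperties
import Algebra.Properties.Semiring.Exp as SemiringExp
import Algebra.Properties.Semiring.Mult as SemiringMult
import Algebra.Properties.Semiring.Sum as SemiringSum
import Algebra.Solver.Ring.NaturalCoefficients.Default as SemiringSolver
open import Data.Bool using (Bool; true; false; if_then_else_)
open import Data.Fin as Fin using (Fin; zero; suc; _<_)
import Data.Fin.Properties as Fin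
open import Data.Fin.Permutation using (permutation)
open import Data.List as List
  using (List; []; _∷_; _++_; [_]; allFin; cartesianProductWith; concatMap; foldr; last;
    length; lookup; map; replicate; tabulate; zipWith)
import Data.List.Membership.DecPropositional as DecMembership
open import Data.List.Membership.Propositional using (_∈_)
open import Data.List.Membership.Propositional.Properties
  using (∈-allFin; ∈-cartesianProductWith⁺; ∈-map⁺; ∈-map⁻; ∈-lookup)
open import Data.List.Membership.Propositional.Properties.WithK using (unique∧set⇒bag)
open import Data.List.Properties using (length-++; length-map; length-replicate; length-tabulate; map-++)
open import Data.List.Relation.Binary.BagAndSetEquality using (∼bag⇒↭)
open import Data.List.Relation.Binary.Permutation.Propositional as ↭ using (_↭_)
open import Data.List.Relation.Unary.All as All using (All; []; _∷_)
open import Data.List.Relation.Unary.AllPairs using ([]; _∷_)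
open import Data.List.Relation.Unary.Any using (here)
open import Data.List.Relation.Unary.Unique.Propositional using (Unique)
open import Data.List.Relation.Unary.Unique.Propositional.Properties using (allFin⁺; cartesianProductWith⁺; map⁺)
open import Data.Maybe using (just)
open import Data.Maybe.Properties using (just-injective)
open import Data.Nat as ℕ using (ℕ; zero; suc; _^_; _≤_; z≤n; s≤s)
open import Data.Nat.Divisibility using (_∣_; _∣0; ∣-refl; ∣1⇒≡1; ∣m∣n⇒∣m+n)
open import Data.Nat.Primality using (Prime; euclidsLemma; prime[2])
import Data.Nat.Properties as ℕ
open import Data.Product using (∃; _×_; _,_; proj₁; proj₂)
open import Data.Sum using (inj₁; inj₂; [_,_]′)
open import Data.Vec as Vec using (Vec; []; _∷_)
import Data.Vec.Properties as Vec
open import Function using (_∘_; id; mk⇔)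
open import Function.Bundles using (_⇔_)
open import Function.Construct.Composition using (_⇔-∘_)
open import Function.Construct.Symmetry using (⇔-sym)
open import Relation.Binary.Definitions using (Tri; tri<; tri≈; tri>)
open import Relation.Binary.PropositionalEquality as ≡ using (_≡_; _≢_; cong; cong₂)
import Relation.Binary.Reasoning.Setoid as SetoidReasoning
open import Relation.Binary.Structures using (IsEquivalence)
open import Relation.Nullary using (¬_; Dec; yes; no; contradiction)
open import Relation.Nullary.Decidable using (⌊_⌋; map′)
open import Relation.Nullary.Reflects using (Reflects; ofʸ; ofⁿ)

-- All nine conditions are equivalent to ℘″(θ) = 0.  Put N = q^d, so that N = 0 in K and x^N = x
-- on K.
--
-- Whenever ℘ divides a^N − a over K, differentiating a^N − a = ℘ Q(a) at θ gives
-- ℘′(θ) Q(a)(θ) = −a′(θ).  This settles the conditions on values of Fermat quotients, the second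
-- derivative of t^N − t = ℘ Q(t) settles those on Q(t)′, and a^[1] satisfies a^[1](θ) = a′(θ) and
-- 2 (a^[1])′(θ) = a″(θ).
--
-- For x in K let Aₓ be the polynomial of degree < d over F with Aₓ(θ) = x.  Since x ↦ Aₓ lists the
-- factors of F_d, Wilson's theorem in K gives F_d(θ) = −1, and F_d′(θ) = −S with
-- S = Σ Aₓ′(θ)/x over x ≠ 0.  Here t Aₓ = A_{θx} + λₓ ℘ with λₓ in F.  Differentiate this once and
-- twice at θ, divide by x and sum over x ≠ 0: with μ = Σ λₓ/x, the terms containing the factor θ
-- cancel after the substitution x ↦ θx, leaving −1 = μ ℘′(θ) and 2 S = μ ℘″(θ).  As F_d + 1 has
-- coefficients in F, it is divisible by ℘² exactly if θ is a double root of it, that is if S = 0.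

-- Everything is read off at the single point θ. For a polynomial with coefficients in F this loses
-- nothing: ℘ is the minimal polynomial of θ over F, so vanishing at θ is divisibility by ℘, with a
-- cofactor again over F. The difference quotient ℘^[1] has coefficients in K only, and its case
-- rests on the factor t - θ of ℘ instead.
--
-- The separability of ℘ comes out of the case a = t: there ℘′(θ) Q(t)(θ) = -1, so both factors are
-- units. In the same way -1 = μ ℘′(θ) makes μ a unit. With 2 ≠ 0 these are the constants cancelled
-- whenever a condition is compared with ℘″(θ) = 0.
--
-- The sum S resists a termwise evaluation because multiplication by θ on K becomes multiplication
-- by t on the Aₓ only up to the correction λₓ ℘. The weights 1/x are chosen by the logarithmic
-- derivative, and they scale under x ↦ θx so that the highest derivative of the Aₓ drops out of the
-- summed relation. This is why one derivative more is taken than is wanted: the first leaves the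
-- values x, whose weighted sum is known and fixes μ, and the second leaves the slopes Aₓ′(θ), hence
-- S.

module PolyRing (R : CommutativeRing 0ℓ 0ℓ) where
  open CommutativeRing R
  open Poly R
  open RingProperties ring
  open SemiringSolver commutativeSemiring using (solve; _:=_; _:+_; _:*_; con)
  open SetoidReasoning setoid

  -- Polynomials as a commutative ring under coefficientwise equality

  coef : P → ℕ → Carrier
  coef []       n       = 0#
  coef (c ∷ as) zero    = c
  coef (c ∷ as) (suc n) = coef as n

  infix 4 _≋_
  -- Comparing coefficients ignores trailing zeros of either list and makes the equivalence and
  -- congruence laws hold degree by degree. Being a record, the relation lets both polynomials be
  -- inferred from a proof.
  record _≋_ (a b : P) : Set where
    constructor coefwise
    field at : ∀ n → coef a n ≈ coef b n
  open _≋_ public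

  ≋-isEquivalence : IsEquivalence _≋_
  ≋-isEquivalence = record
    { refl  = coefwise λ _ → refl
    ; sym   = λ e → coefwise λ n → sym (at e n)
    ; trans = λ e f → coefwise λ n → trans (at e n) (at f n)
    }

  open IsEquivalence ≋-isEquivalence public using ()
    renaming (refl to ≋-refl; sym to ≋-sym; trans to ≋-trans; reflexive to ≋-reflexive)

  ∷-cong : ∀ {x y a b} → x ≈ y → a ≋ b → x ∷ a ≋ y ∷ b
  ∷-cong e f = coefwise λ { zero → e ; (suc n) → at f n }

  tail-≋ : ∀ {x y a b} → x ∷ a ≋ y ∷ b → a ≋ b
  tail-≋ e = coefwise (at e ∘ suc)

  tail-zero : ∀ {x a} → x ∷ a ≋ [] → a ≋ []
  tail-zero e = coefwise (at e ∘ suc)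

  0∷-zero : ∀ {x a} → x ≈ 0# → a ≋ [] → x ∷ a ≋ []
  0∷-zero e f = coefwise λ { zero → e ; (suc n) → at f n }

  coef-+ : ∀ a b n → coef (a +P b) n ≈ coef a n + coef b n
  coef-+ []      b       n       = sym (+-identityˡ _)
  coef-+ (x ∷ a) []      n       = sym (+-identityʳ _)
  coef-+ (x ∷ a) (y ∷ b) zero    = refl
  coef-+ (x ∷ a) (y ∷ b) (suc n) = coef-+ a b n

  coef-· : ∀ c a n → coef (c ·P a) n ≈ c * coef a n
  coef-· c []      n       = sym (zeroʳ c)
  coef-· c (x ∷ a) zero    = refl
  coef-· c (x ∷ a) (suc n) = coef-· c a n

  coef-neg : ∀ a n → coef (-P a) n ≈ - coef a n
  coef-neg []      n       = sym -0#≈0#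
  coef-neg (x ∷ a) zero    = refl
  coef-neg (x ∷ a) (suc n) = coef-neg a n

  coef-- : ∀ a b n → coef (a -P b) n ≈ coef a n - coef b n
  coef-- a b n = trans (coef-+ a (-P b) n) (+-congˡ (coef-neg b n))

  IsZeroP⇒≋ : ∀ {a} → IsZeroP a → a ≋ []
  IsZeroP⇒≋ []       = ≋-refl
  IsZeroP⇒≋ (e ∷ es) = 0∷-zero e (IsZeroP⇒≋ es)

  ≋⇒IsZeroP : ∀ {a} → a ≋ [] → IsZeroP a
  ≋⇒IsZeroP {[]}    e = []
  ≋⇒IsZeroP {x ∷ a} e = at e 0 ∷ ≋⇒IsZeroP (tail-zero e)

  -P-zero⇒≋ : ∀ a b → a -P b ≋ [] → a ≋ b
  -P-zero⇒≋ a b e = coefwise λ n → x∙y⁻¹≈ε⇒x≈y _ _ (trans (sym (coef-- a b n)) (at e n))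

  ≈P⇒≋ : ∀ {a b} → a ≈P b → a ≋ b
  ≈P⇒≋ {a} {b} e = -P-zero⇒≋ a b (IsZeroP⇒≋ e)

  ≋⇒≈P : ∀ {a b} → a ≋ b → a ≈P b
  ≋⇒≈P {a} {b} e = ≋⇒IsZeroP (coefwise λ n →
    trans (coef-- a b n) (x≈y⇒x∙y⁻¹≈ε (at e n)))

  +P-cong : ∀ {a a′ b b′} → a ≋ a′ → b ≋ b′ → a +P b ≋ a′ +P b′
  +P-cong {a} {a′} {b} {b′} e f = coefwise λ n → begin
    coef (a +P b) n        ≈⟨ coef-+ a b n ⟩
    coef a n + coef b n    ≈⟨ +-cong (at e n) (at f n) ⟩
    coef a′ n + coef b′ n  ≈⟨ coef-+ a′ b′ n ⟨
    coef (a′ +P b′) n      ∎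

  +P-assoc : ∀ a b c → (a +P b) +P c ≋ a +P (b +P c)
  +P-assoc a b c = coefwise λ n → begin
    coef ((a +P b) +P c) n             ≈⟨ coef-+ (a +P b) c n ⟩
    coef (a +P b) n + coef c n         ≈⟨ +-congʳ (coef-+ a b n) ⟩
    coef a n + coef b n + coef c n     ≈⟨ +-assoc _ _ _ ⟩
    coef a n + (coef b n + coef c n)   ≈⟨ +-congˡ (coef-+ b c n) ⟨
    coef a n + coef (b +P c) n         ≈⟨ coef-+ a (b +P c) n ⟨
    coef (a +P (b +P c)) n             ∎

  +P-comm : ∀ a b → a +P b ≋ b +P a
  +P-comm a b = coefwise λ n →
    trans (coef-+ a b n) (trans (+-comm _ _) (sym (coef-+ b a n)))

  +P-identityˡ : ∀ a → [] +P a ≋ a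
  +P-identityˡ a = ≋-refl

  +P-identityʳ : ∀ a → a +P [] ≋ a
  +P-identityʳ a = +P-comm a []

  -P-cong : ∀ {a b} → a ≋ b → -P a ≋ -P b
  -P-cong {a} {b} e = coefwise λ n →
    trans (coef-neg a n) (trans (-‿cong (at e n)) (sym (coef-neg b n)))

  -P-inverseˡ : ∀ a → -P a +P a ≋ []
  -P-inverseˡ a = coefwise λ n →
    trans (coef-+ (-P a) a n) (trans (+-congʳ (coef-neg a n)) (-‿inverseˡ _))

  -P-inverseʳ : ∀ a → a -P a ≋ []
  -P-inverseʳ a = ≋-trans (+P-comm a (-P a)) (-P-inverseˡ a)

  ·P-cong : ∀ {x y a b} → x ≈ y → a ≋ b → x ·P a ≋ y ·P b
  ·P-cong {x} {y} {a} {b} e f = coefwise λ n →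
    trans (coef-· x a n) (trans (*-cong e (at f n)) (sym (coef-· y b n)))

  ·P-distribˡ : ∀ x a b → x ·P (a +P b) ≋ x ·P a +P x ·P b
  ·P-distribˡ x a b = coefwise λ n → begin
    coef (x ·P (a +P b)) n              ≈⟨ coef-· x (a +P b) n ⟩
    x * coef (a +P b) n                 ≈⟨ *-congˡ (coef-+ a b n) ⟩
    x * (coef a n + coef b n)           ≈⟨ distribˡ _ _ _ ⟩
    x * coef a n + x * coef b n         ≈⟨ +-cong (coef-· x a n) (coef-· x b n) ⟨
    coef (x ·P a) n + coef (x ·P b) n   ≈⟨ coef-+ (x ·P a) (x ·P b) n ⟨
    coef (x ·P a +P x ·P b) n           ∎

  ·P-distribʳ : ∀ a x y → (x + y) ·P a ≋ x ·P a +P y ·P a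
  ·P-distribʳ a x y = coefwise λ n → begin
    coef ((x + y) ·P a) n               ≈⟨ coef-· (x + y) a n ⟩
    (x + y) * coef a n                  ≈⟨ distribʳ _ _ _ ⟩
    x * coef a n + y * coef a n         ≈⟨ +-cong (coef-· x a n) (coef-· y a n) ⟨
    coef (x ·P a) n + coef (y ·P a) n   ≈⟨ coef-+ (x ·P a) (y ·P a) n ⟨
    coef (x ·P a +P y ·P a) n           ∎

  ·P-assoc : ∀ x y a → (x * y) ·P a ≋ x ·P (y ·P a)
  ·P-assoc x y a = coefwise λ n → begin
    coef ((x * y) ·P a) n     ≈⟨ coef-· (x * y) a n ⟩
    x * y * coef a n          ≈⟨ *-assoc _ _ _ ⟩
    x * (y * coef a n)        ≈⟨ *-congˡ (coef-· y a n) ⟨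
    x * coef (y ·P a) n       ≈⟨ coef-· x (y ·P a) n ⟨
    coef (x ·P (y ·P a)) n    ∎

  ·P-zeroˡ : ∀ {x} a → x ≈ 0# → x ·P a ≋ []
  ·P-zeroˡ {x} a e = coefwise λ n →
    trans (coef-· x a n) (trans (*-congʳ e) (zeroˡ _))

  ·P-identityˡ : ∀ a → 1# ·P a ≋ a
  ·P-identityˡ a = coefwise λ n → trans (coef-· 1# a n) (*-identityˡ _)

  +P-interchange : ∀ a b c d → (a +P b) +P (c +P d) ≋ (a +P c) +P (b +P d)
  +P-interchange a b c d =
    ≋-trans (+P-assoc a b (c +P d))
    (≋-trans (+P-cong (≋-refl {a}) (≋-trans (≋-sym (+P-assoc b c d))
               (≋-trans (+P-cong (+P-comm b c) (≋-refl {d})) (+P-assoc c b d))))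
             (≋-sym (+P-assoc a c (b +P d))))

  *P-zeroʳ : ∀ a → a *P [] ≋ []
  *P-zeroʳ []      = ≋-refl
  *P-zeroʳ (x ∷ a) = 0∷-zero refl (*P-zeroʳ a)

  *P-congˡ : ∀ a {b b′} → b ≋ b′ → a *P b ≋ a *P b′
  *P-congˡ []      e = ≋-refl
  *P-congˡ (x ∷ a) e = +P-cong (·P-cong refl e) (∷-cong refl (*P-congˡ a e))

  *P-zeroˡ : ∀ {a} b → a ≋ [] → a *P b ≋ []
  *P-zeroˡ {[]}    b e = ≋-refl
  *P-zeroˡ {x ∷ a} b e =
    +P-cong {a′ = []} {b′ = []} (·P-zeroˡ b (at e 0))
      (0∷-zero refl (*P-zeroˡ b (tail-zero e)))

  *P-congʳ : ∀ {a a′} b → a ≋ a′ → a *P b ≋ a′ *P b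
  *P-congʳ {[]}    {a′}    b e = ≋-sym (*P-zeroˡ b (≋-sym e))
  *P-congʳ {x ∷ a} {[]}    b e = *P-zeroˡ b e
  *P-congʳ {x ∷ a} {y ∷ a′} b e =
    +P-cong (·P-cong (at e 0) (≋-refl {b})) (∷-cong refl (*P-congʳ b (tail-≋ e)))

  *P-cong : ∀ {a a′ b b′} → a ≋ a′ → b ≋ b′ → a *P b ≋ a′ *P b′
  *P-cong {a′ = a′} {b} e f = ≋-trans (*P-congʳ b e) (*P-congˡ a′ f)

  *P-distribˡ : ∀ a b c → a *P (b +P c) ≋ a *P b +P a *P c
  *P-distribˡ []      b c = ≋-refl
  *P-distribˡ (x ∷ a) b c =
    ≋-trans (+P-cong (·P-distribˡ x b c)
               (∷-cong (sym (+-identityˡ 0#)) (*P-distribˡ a b c)))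
            (+P-interchange (x ·P b) (x ·P c) (0# ∷ a *P b) (0# ∷ a *P c))

  *P-distribʳ : ∀ c a b → (a +P b) *P c ≋ a *P c +P b *P c
  *P-distribʳ c []      b       = ≋-refl
  *P-distribʳ c (x ∷ a) []      = ≋-sym (+P-identityʳ _)
  *P-distribʳ c (x ∷ a) (y ∷ b) =
    ≋-trans (+P-cong (·P-distribʳ c x y)
               (∷-cong (sym (+-identityˡ 0#)) (*P-distribʳ c a b)))
            (+P-interchange (x ·P c) (y ·P c) (0# ∷ a *P c) (0# ∷ b *P c))

  ·P-*P : ∀ x a b → (x ·P a) *P b ≋ x ·P (a *P b)
  ·P-*P x []      b = ≋-refl
  ·P-*P x (y ∷ a) b =
    ≋-trans (+P-cong (·P-assoc x y b) (∷-cong (sym (zeroʳ x)) (·P-*P x a b)))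
            (≋-sym (·P-distribˡ x (y ·P b) (0# ∷ a *P b)))

  0∷-*P : ∀ a b → (0# ∷ a) *P b ≋ 0# ∷ a *P b
  0∷-*P a b = +P-cong {a′ = []} (·P-zeroˡ b refl) ≋-refl

  *P-assoc : ∀ a b c → (a *P b) *P c ≋ a *P (b *P c)
  *P-assoc []      b c = ≋-refl
  *P-assoc (x ∷ a) b c =
    ≋-trans (*P-distribʳ c (x ·P b) (0# ∷ a *P b))
    (+P-cong (·P-*P x b c)
             (≋-trans (0∷-*P (a *P b) c) (∷-cong refl (*P-assoc a b c))))

  -- `_*P_` recurses on its left factor; this is the matching recursion on the right factor.
  -- Commutativity follows from it, and division uses it to extend a quotient by one coefficient.
  *P-∷ : ∀ a y b → a *P (y ∷ b) ≋ y ·P a +P (0# ∷ a *P b)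
  *P-∷ []      y b = ≋-sym (0∷-zero refl ≋-refl)
  *P-∷ (x ∷ a) y b = ∷-cong (+-congʳ (*-comm x y))
    (≋-trans (+P-cong (≋-refl {x ·P b}) (*P-∷ a y b))
    (≋-trans (≋-sym (+P-assoc (x ·P b) (y ·P a) (0# ∷ a *P b)))
    (≋-trans (+P-cong (+P-comm (x ·P b) (y ·P a)) ≋-refl)
             (+P-assoc (y ·P a) (x ·P b) (0# ∷ a *P b)))))

  *P-comm : ∀ a b → a *P b ≋ b *P a
  *P-comm []      b = ≋-sym (*P-zeroʳ b)
  *P-comm (x ∷ a) b =
    ≋-trans (+P-cong (≋-refl {x ·P b}) (∷-cong refl (*P-comm a b)))
            (≋-sym (*P-∷ b x a))

  constP-*P : ∀ c a → constP c *P a ≋ c ·P a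
  constP-*P c a =
    ≋-trans (+P-cong (≋-refl {c ·P a}) (0∷-zero refl ≋-refl)) (+P-identityʳ (c ·P a))

  *P-identityˡ : ∀ a → oneP *P a ≋ a
  *P-identityˡ a = ≋-trans (constP-*P 1# a) (·P-identityˡ a)

  *P-identityʳ : ∀ a → a *P oneP ≋ a
  *P-identityʳ a = ≋-trans (*P-comm a oneP) (*P-identityˡ a)

  polyRing : CommutativeRing 0ℓ 0ℓ
  polyRing = record
    { Carrier = P ; _≈_ = _≋_ ; _+_ = _+P_ ; _*_ = _*P_ ; -_ = -P_ ; 0# = [] ; 1# = oneP
    ; isCommutativeRing = record
      { isRing = record
        { +-isAbelianGroup = record
          { isGroup = record
            { isMonoid = record
              { isSemigroup = record
                { isMagma = record { isEquivalence = ≋-isEquivalence ; ∙-cong = +P-cong }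
                ; assoc = +P-assoc }
              ; identity = +P-identityˡ , +P-identityʳ }
            ; inverse = -P-inverseˡ , -P-inverseʳ
            ; ⁻¹-cong = -P-cong }
          ; comm = +P-comm }
        ; *-cong = *P-cong
        ; *-assoc = *P-assoc
        ; *-identity = *P-identityˡ , *P-identityʳ
        ; distrib = *P-distribˡ , *P-distribʳ }
      ; *-comm = *P-comm } }

  private module PR = CommutativeRing polyRing

  ^P-cong : ∀ {a b} n → a ≋ b → a ^P n ≋ b ^P n
  ^P-cong zero    e = ≋-refl
  ^P-cong (suc n) e = *P-cong e (^P-cong n e)

  -- Evaluation and formal differentiation

  eval-zero : ∀ {a} x → a ≋ [] → eval a x ≈ 0#
  eval-zero {[]}    x e = refl
  eval-zero {c ∷ a} x e = begin
    c + x * eval a x   ≈⟨ +-cong (at e 0) (*-congˡ (eval-zero x (tail-zero e))) ⟩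
    0# + x * 0#        ≈⟨ solve 1 (λ x → con 0 :+ x :* con 0 := con 0) refl x ⟩
    0#                 ∎

  eval-cong : ∀ {a b} x → a ≋ b → eval a x ≈ eval b x
  eval-cong {[]}    {b}     x e = sym (eval-zero x (≋-sym e))
  eval-cong {c ∷ a} {[]}    x e = eval-zero x e
  eval-cong {c ∷ a} {d ∷ b} x e = +-cong (at e 0) (*-congˡ (eval-cong x (tail-≋ e)))

  eval-+ : ∀ a b x → eval (a +P b) x ≈ eval a x + eval b x
  eval-+ []      b       x = sym (+-identityˡ _)
  eval-+ (c ∷ a) []      x = sym (+-identityʳ _)
  eval-+ (c ∷ a) (d ∷ b) x = begin
    c + d + x * eval (a +P b) x              ≈⟨ +-congˡ (*-congˡ (eval-+ a b x)) ⟩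
    c + d + x * (eval a x + eval b x)        ≈⟨ solve 5 (λ c d x a b →
      c :+ d :+ x :* (a :+ b) := c :+ x :* a :+ (d :+ x :* b)) refl c d x _ _ ⟩
    c + x * eval a x + (d + x * eval b x)    ∎

  eval-· : ∀ c a x → eval (c ·P a) x ≈ c * eval a x
  eval-· c []      x = sym (zeroʳ c)
  eval-· c (d ∷ a) x = begin
    c * d + x * eval (c ·P a) x   ≈⟨ +-congˡ (*-congˡ (eval-· c a x)) ⟩
    c * d + x * (c * eval a x)    ≈⟨ solve 4 (λ c d x a →
      c :* d :+ x :* (c :* a) := c :* (d :+ x :* a)) refl c d x _ ⟩
    c * (d + x * eval a x)        ∎

  eval-* : ∀ a b x → eval (a *P b) x ≈ eval a x * eval b x
  eval-* []      b x = sym (zeroˡ _)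
  eval-* (c ∷ a) b x = begin
    eval (c ·P b +P (0# ∷ a *P b)) x             ≈⟨ eval-+ (c ·P b) _ x ⟩
    eval (c ·P b) x + (0# + x * eval (a *P b) x) ≈⟨ +-cong (eval-· c b x) (+-congˡ (*-congˡ (eval-* a b x))) ⟩
    c * eval b x + (0# + x * (eval a x * eval b x)) ≈⟨ solve 4 (λ c b x a →
      c :* b :+ (con 0 :+ x :* (a :* b)) := (c :+ x :* a) :* b) refl c _ x _ ⟩
    (c + x * eval a x) * eval b x                ∎

  eval-neg : ∀ a x → eval (-P a) x ≈ - eval a x
  eval-neg a x = +-inverseˡ-unique _ _
    (trans (sym (eval-+ (-P a) a x)) (eval-zero x (-P-inverseˡ a)))

  eval-const : ∀ c x → eval (constP c) x ≈ c
  eval-const c x = trans (+-congˡ (zeroʳ x)) (+-identityʳ c)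

  eval-sub : ∀ a b x → eval (a -P b) x ≈ eval a x - eval b x
  eval-sub a b x = trans (eval-+ a (-P b) x) (+-congˡ (eval-neg b x))

  deriv-zero : ∀ {a} → a ≋ [] → deriv a ≋ []
  deriv-zero {[]}    e = ≋-refl
  deriv-zero {c ∷ a} e =
    +P-cong {b′ = []} (tail-zero e) (0∷-zero refl (deriv-zero (tail-zero e)))

  deriv-cong : ∀ {a b} → a ≋ b → deriv a ≋ deriv b
  deriv-cong {[]}    {b}     e = ≋-sym (deriv-zero (≋-sym e))
  deriv-cong {c ∷ a} {[]}    e = deriv-zero e
  deriv-cong {c ∷ a} {d ∷ b} e =
    +P-cong (tail-≋ e) (∷-cong refl (deriv-cong (tail-≋ e)))

  deriv-+ : ∀ a b → deriv (a +P b) ≋ deriv a +P deriv b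
  deriv-+ []      b       = ≋-refl
  deriv-+ (c ∷ a) []      = ≋-sym (+P-identityʳ _)
  deriv-+ (c ∷ a) (d ∷ b) =
    ≋-trans (+P-cong (≋-refl {a +P b}) (∷-cong (sym (+-identityˡ 0#)) (deriv-+ a b)))
            (+P-interchange a b (0# ∷ deriv a) (0# ∷ deriv b))

  deriv-· : ∀ c a → deriv (c ·P a) ≋ c ·P deriv a
  deriv-· c []      = ≋-refl
  deriv-· c (d ∷ a) =
    ≋-trans (+P-cong (≋-refl {c ·P a}) (∷-cong (sym (zeroʳ c)) (deriv-· c a)))
            (≋-sym (·P-distribˡ c a (0# ∷ deriv a)))

  deriv-neg : ∀ a → deriv (-P a) ≋ -P deriv a
  deriv-neg a = +-inverseˡ-uniqueP _ _
    (≋-trans (≋-sym (deriv-+ (-P a) a)) (deriv-zero (-P-inverseˡ a)))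
    where open RingProperties PR.ring using () renaming (+-inverseˡ-unique to +-inverseˡ-uniqueP)

  deriv-sub : ∀ a b → deriv (a -P b) ≋ deriv a -P deriv b
  deriv-sub a b = ≋-trans (deriv-+ a (-P b)) (+P-cong (≋-refl {deriv a}) (deriv-neg b))

  deriv-* : ∀ a b → deriv (a *P b) ≋ deriv a *P b +P a *P deriv b
  deriv-* []      b = ≋-refl
  deriv-* (c ∷ a) b =
    ≋-trans (deriv-+ (c ·P b) (0# ∷ a *P b))
    (≋-trans (+P-cong (deriv-· c b) (+P-cong (≋-refl {a *P b}) (∷-cong (sym (+-identityˡ 0#)) (deriv-* a b))))
    (≋-trans (solveP 4 (λ p q r s →
        p :+P (q :+P (r :+P s)) :=P (q :+P r) :+P (p :+P s)) ≋-refl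
        (c ·P deriv b) (a *P b) (0# ∷ deriv a *P b) (0# ∷ a *P deriv b))
    (+P-cong (≋-trans (+P-cong (≋-refl {a *P b}) (≋-sym (0∷-*P (deriv a) b)))
                      (≋-sym (*P-distribʳ b a (0# ∷ deriv a)))) ≋-refl)))
    where open SemiringSolver PR.commutativeSemiring using ()
            renaming (solve to solveP; _:=_ to _:=P_; _:+_ to _:+P_; _:*_ to _:*P_)

-- Values of first and second derivatives, and the difference quotient

module Derivatives (R : CommutativeRing 0ℓ 0ℓ) where
  open CommutativeRing R
  open Poly R
  open PolyRing R
  open RingProperties ring
  open SemiringExp semiring using () renaming (_^_ to _^ᴿ_)
  open SemiringMult semiring using () renaming (_×_ to _⨯_)
  open SemiringSolver commutativeSemiring using (solve; _:=_; _:+_; _:*_; con)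
  open SetoidReasoning setoid

  eval₁ eval₂ : P → Carrier → Carrier
  eval₁ a = eval (deriv a)
  eval₂ a = eval (deriv (deriv a))

  eval₁-cong : ∀ {a b} x → a ≋ b → eval₁ a x ≈ eval₁ b x
  eval₁-cong x e = eval-cong x (deriv-cong e)

  eval₂-cong : ∀ {a b} x → a ≋ b → eval₂ a x ≈ eval₂ b x
  eval₂-cong x e = eval₁-cong x (deriv-cong e)

  eval₁-+ : ∀ a b x → eval₁ (a +P b) x ≈ eval₁ a x + eval₁ b x
  eval₁-+ a b x = trans (eval-cong x (deriv-+ a b)) (eval-+ (deriv a) (deriv b) x)

  eval₂-+ : ∀ a b x → eval₂ (a +P b) x ≈ eval₂ a x + eval₂ b x
  eval₂-+ a b x = trans (eval₁-cong x (deriv-+ a b)) (eval₁-+ (deriv a) (deriv b) x)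

  eval₁-· : ∀ c a x → eval₁ (c ·P a) x ≈ c * eval₁ a x
  eval₁-· c a x = trans (eval-cong x (deriv-· c a)) (eval-· c (deriv a) x)

  eval₂-· : ∀ c a x → eval₂ (c ·P a) x ≈ c * eval₂ a x
  eval₂-· c a x = trans (eval₁-cong x (deriv-· c a)) (eval₁-· c (deriv a) x)

  eval₁-sub : ∀ a b x → eval₁ (a -P b) x ≈ eval₁ a x - eval₁ b x
  eval₁-sub a b x = trans (eval-cong x (deriv-sub a b)) (eval-sub (deriv a) (deriv b) x)

  eval₂-sub : ∀ a b x → eval₂ (a -P b) x ≈ eval₂ a x - eval₂ b x
  eval₂-sub a b x = trans (eval₁-cong x (deriv-sub a b)) (eval₁-sub (deriv a) (deriv b) x)

  eval₁-* : ∀ a b x → eval₁ (a *P b) x ≈ eval₁ a x * eval b x + eval a x * eval₁ b x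
  eval₁-* a b x = begin
    eval₁ (a *P b) x                            ≈⟨ eval-cong x (deriv-* a b) ⟩
    eval (deriv a *P b +P a *P deriv b) x       ≈⟨ eval-+ (deriv a *P b) (a *P deriv b) x ⟩
    eval (deriv a *P b) x + eval (a *P deriv b) x
      ≈⟨ +-cong (eval-* (deriv a) b x) (eval-* a (deriv b) x) ⟩
    eval₁ a x * eval b x + eval a x * eval₁ b x ∎

  eval₂-* : ∀ a b x → eval₂ (a *P b) x ≈
    eval₂ a x * eval b x + (eval₁ a x * eval₁ b x + eval₁ a x * eval₁ b x) + eval a x * eval₂ b x
  eval₂-* a b x = begin
    eval₂ (a *P b) x                                  ≈⟨ eval₁-cong x (deriv-* a b) ⟩
    eval₁ (deriv a *P b +P a *P deriv b) x            ≈⟨ eval₁-+ (deriv a *P b) (a *P deriv b) x ⟩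
    eval₁ (deriv a *P b) x + eval₁ (a *P deriv b) x
      ≈⟨ +-cong (eval₁-* (deriv a) b x) (eval₁-* a (deriv b) x) ⟩
    _ ≈⟨ solve 4 (λ u v w z → (u :+ v) :+ (w :+ z) := u :+ (v :+ w) :+ z) refl _ _ _ _ ⟩
    _ ∎

  eval₁-X : ∀ x → eval₁ X x ≈ 1#
  eval₁-X x = solve 1 (λ x →
    (con 1 :+ con 0) :+ x :* (con 0 :+ x :* con 0) := con 1) refl x

  eval₂-X : ∀ x → eval₂ X x ≈ 0#
  eval₂-X x = solve 1 (λ x → 
    (con 0 :+ con 0) :+ x :* (con 0 :+ x :* con 0) := con 0) refl x

  eval₁-∷ : ∀ c a x → eval₁ (c ∷ a) x ≈ eval a x + x * eval₁ a x
  eval₁-∷ c a x = trans (eval-+ a (0# ∷ deriv a) x) (+-congˡ (+-identityˡ _))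

  eval₂-∷ : ∀ c a x → eval₂ (c ∷ a) x ≈ eval₁ a x + eval₁ a x + x * eval₂ a x
  eval₂-∷ c a x = begin
    eval₂ (c ∷ a) x                            ≈⟨ eval₁-+ a (0# ∷ deriv a) x ⟩
    eval₁ a x + eval₁ (0# ∷ deriv a) x         ≈⟨ +-congˡ (eval₁-∷ 0# (deriv a) x) ⟩
    eval₁ a x + (eval₁ a x + x * eval₂ a x)    ≈⟨ +-assoc _ _ _ ⟨
    eval₁ a x + eval₁ a x + x * eval₂ a x      ∎

  eval-^ : ∀ a n x → eval (a ^P n) x ≈ eval a x ^ᴿ n
  eval-^ a zero    x = eval-const 1# x
  eval-^ a (suc n) x = trans (eval-* a (a ^P n) x) (*-congˡ (eval-^ a n x))

  deriv-const : ∀ c → deriv (constP c) ≋ []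
  deriv-const c = 0∷-zero refl ≋-refl

  deriv-^ : ∀ a n → deriv (a ^P suc n) ≋ (suc n ⨯ 1#) ·P (deriv a *P a ^P n)
  deriv-^ a zero =
    ≋-trans (deriv-cong (*P-identityʳ a))
    (≋-trans (≋-sym (*P-identityʳ (deriv a)))
    (≋-trans (≋-sym (·P-identityˡ _)) (·P-cong (sym (+-identityʳ 1#)) ≋-refl)))
  deriv-^ a (suc n) =
    ≋-trans (deriv-* a (a ^P suc n))
    (≋-trans (+P-cong (≋-sym (·P-identityˡ _)) a*deriv)
             (≋-sym (·P-distribʳ (deriv a *P a ^P suc n) 1# (suc n ⨯ 1#))))
    where
    open CommutativeRing polyRing using () renaming (*-commutativeSemigroup to PS)
    open SemigroupProperties PS using (x∙yz≈y∙xz)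
    a*deriv : a *P deriv (a ^P suc n) ≋ (suc n ⨯ 1#) ·P (deriv a *P a ^P suc n)
    a*deriv =
      ≋-trans (*P-congˡ a (deriv-^ a n))
      (≋-trans (*P-comm a _)
      (≋-trans (·P-*P (suc n ⨯ 1#) (deriv a *P a ^P n) a)
      (·P-cong refl (≋-trans (*P-comm (deriv a *P a ^P n) a) (x∙yz≈y∙xz a (deriv a) (a ^P n))))))

  deriv-^-char : ∀ n → n ⨯ 1# ≈ 0# → ∀ a → deriv (a ^P n) ≋ []
  deriv-^-char zero    e a = deriv-const 1#
  deriv-^-char (suc n) e a = ≋-trans (deriv-^ a n) (·P-zeroˡ _ e)

  eval-diffQuot : ∀ a x → eval (diffQuot x a) x ≈ eval₁ a x
  eval-diffQuot []      x = refl
  eval-diffQuot (c ∷ a) x =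
    trans (+-congˡ (*-congˡ (eval-diffQuot a x))) (sym (eval₁-∷ c a x))

  -- With D the quotient of a, the quotient of c + t a is a(x) + t D. Differentiated once and
  -- doubled, this is 2 D + 2 t D′; differentiated twice, c + t a is 2 a′ + t a″. At x the two agree
  -- by induction. The doubled form avoids dividing by 2 in a general ring.
  eval₁-diffQuot : ∀ a x → eval₁ (diffQuot x a) x + eval₁ (diffQuot x a) x ≈ eval₂ a x
  eval₁-diffQuot []      x = +-identityˡ 0#
  eval₁-diffQuot (c ∷ a) x = begin
    eval₁ (eval a x ∷ D) x + eval₁ (eval a x ∷ D) x
      ≈⟨ +-cong (eval₁-∷ (eval a x) D x) (eval₁-∷ (eval a x) D x) ⟩
    (eval D x + x * eval₁ D x) + (eval D x + x * eval₁ D x)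
      ≈⟨ solve 3 (λ x y z → (y :+ x :* z) :+ (y :+ x :* z) := (y :+ y) :+ x :* (z :+ z)) refl x _ _ ⟩
    (eval D x + eval D x) + x * (eval₁ D x + eval₁ D x)
      ≈⟨ +-cong (+-cong (eval-diffQuot a x) (eval-diffQuot a x)) (*-congˡ (eval₁-diffQuot a x)) ⟩
    (eval₁ a x + eval₁ a x) + x * eval₂ a x
      ≈⟨ eval₂-∷ c a x ⟨
    eval₂ (c ∷ a) x ∎
    where D = diffQuot x a

  linear : Carrier → P
  linear x = - x ∷ 1# ∷ []

  -- Synthetic division: the entries of `diffQuot x a` are the partial values of Horner's scheme for
  -- a at x, and these are the coefficients of the quotient by t - x.
  diffQuot-spec : ∀ a x → a ≋ diffQuot x a *P linear x +P constP (eval a x)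
  diffQuot-spec []      x = ≋-sym (0∷-zero refl ≋-refl)
  diffQuot-spec (c ∷ a) x = ∷-cong head≈ (≋-trans (diffQuot-spec a x) tail≋)
    where
    e = eval a x
    head≈ : c ≈ e * - x + 0# + (c + x * e)
    head≈ = begin
      c                             ≈⟨ +-identityʳ c ⟨
      c + 0#                        ≈⟨ +-congˡ (-‿inverseˡ (x * e)) ⟨
      c + (- (x * e) + x * e)       ≈⟨ +-congˡ (+-congʳ (-‿distribˡ-* x e)) ⟩
      c + ((- x) * e + x * e)       ≈⟨ solve 4 (λ c y x e →
        c :+ (y :* e :+ x :* e) := e :* y :+ con 0 :+ (c :+ x :* e)) refl c (- x) x e ⟩
      e * - x + 0# + (c + x * e)    ∎
    tail≋ : diffQuot x a *P linear x +P constP e ≋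
            ((e * 1#) ∷ []) +P diffQuot x a *P linear x +P []
    tail≋ = ≋-trans (+P-comm _ (constP e))
      (≋-trans (+P-cong {a = constP e} {b = diffQuot x a *P linear x} (∷-cong (sym (*-identityʳ e)) ≋-refl) ≋-refl)
               (≋-sym (+P-identityʳ (((e * 1#) ∷ []) +P diffQuot x a *P linear x))))

  root⇒diffQuot : ∀ a x → eval a x ≈ 0# → a ≋ diffQuot x a *P linear x
  root⇒diffQuot a x e = ≋-trans (diffQuot-spec a x)
    (≋-trans (+P-cong ≋-refl (0∷-zero e ≋-refl)) (+P-identityʳ _))

-- Long division by monic polynomials

module Division (R : CommutativeRing 0ℓ 0ℓ) where
  open CommutativeRing R
  open Poly R
  open PolyRing R
  open RingProperties ring
  open SetoidReasoning setoid

  DegreeBelow : ℕ → P → Set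
  DegreeBelow m a = ∀ i → m ≤ i → coef a i ≈ 0#

  Monic : ℕ → P → Set
  Monic m g = DegreeBelow (suc m) g × coef g m ≈ 1#

  -- MonicOfDegree demands a leading coefficient propositionally equal to 1#, which a
  -- ring homomorphism preserves only up to ≈.
  MonicList : ℕ → P → Set
  MonicList d g = g ≋ lowCoeffs g ++ [ 1# ] × length (lowCoeffs g) ≡ d

  length⇒DegreeBelow : ∀ a → DegreeBelow (length a) a
  length⇒DegreeBelow []      i       _       = refl
  length⇒DegreeBelow (c ∷ a) (suc i) (s≤s l) = length⇒DegreeBelow a i l

  DegreeBelow-zero : ∀ {a} → DegreeBelow 0 a → a ≋ []
  DegreeBelow-zero b = coefwise λ n → b n z≤n

  Monic-++1 : ∀ gs → Monic (length gs) (gs ++ [ 1# ])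
  Monic-++1 []       = (λ { (suc i) l → refl }) , refl
  Monic-++1 (g ∷ gs) with Monic-++1 gs
  ... | b , e = (λ { (suc i) (s≤s l) → b i l }) , e

  -- Beyond degree m the coefficients of g (y + t b) are those of g b shifted by one, since g
  -- contributes nothing there. So b = 0 by induction, and then y is the coefficient of degree m. A
  -- leading coefficient 1 suffices for this over any ring.
  monic-*-cancel : ∀ {m} g → Monic m g → ∀ b → DegreeBelow m (g *P b) → b ≋ []
  monic-*-cancel g mg [] _ = ≋-refl
  monic-*-cancel {m} g mg@(bg , g≈1) (y ∷ b) bgb = 0∷-zero y≈0 b≋0
    where
    coef-gyb : ∀ i → coef (g *P (y ∷ b)) i ≈ y * coef g i + coef (0# ∷ g *P b) i
    coef-gyb i = trans (at (*P-∷ g y b) i)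
      (trans (coef-+ (y ·P g) (0# ∷ g *P b) i) (+-congʳ (coef-· y g i)))
    b≋0 : b ≋ []
    b≋0 = monic-*-cancel g mg b λ i m≤i → begin
      coef (g *P b) i                          ≈⟨ +-identityˡ _ ⟨
      0# + coef (g *P b) i                     ≈⟨ +-congʳ (zeroʳ y) ⟨
      y * 0# + coef (g *P b) i                 ≈⟨ +-congʳ (*-congˡ (bg (suc i) (s≤s m≤i))) ⟨
      y * coef g (suc i) + coef (g *P b) i     ≈⟨ coef-gyb (suc i) ⟨
      coef (g *P (y ∷ b)) (suc i)              ≈⟨ bgb (suc i) (ℕ.m≤n⇒m≤1+n m≤i) ⟩
      0#                                       ∎
    gb≋0 : (0# ∷ g *P b) ≋ []
    gb≋0 = 0∷-zero refl (≋-trans (*P-congˡ g b≋0) (*P-zeroʳ g))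
    y≈0 : y ≈ 0#
    y≈0 = begin
      y                                      ≈⟨ *-identityʳ y ⟨
      y * 1#                                 ≈⟨ *-congˡ g≈1 ⟨
      y * coef g m                           ≈⟨ +-identityʳ _ ⟨
      y * coef g m + 0#                      ≈⟨ +-congˡ (at gb≋0 m) ⟨
      y * coef g m + coef (0# ∷ g *P b) m    ≈⟨ coef-gyb m ⟨
      coef (g *P (y ∷ b)) m                  ≈⟨ bgb m ℕ.≤-refl ⟩
      0#                                     ∎

  private
    -- Stated for any two functions that obey the recursion of `initLast`: that function is private,
    -- and its components are available only as solutions of unification. For them the four
    -- equations hold by `refl`.
    snoc-initLast : (low : Carrier → List Carrier → List Carrier)
                    (top : Carrier → List Carrier → Carrier) →
                    (∀ c → low c [] ≡ []) → (∀ c x xs → low c (x ∷ xs) ≡ c ∷ low x xs) →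
                    (∀ c → top c [] ≡ c) → (∀ c x xs → top c (x ∷ xs) ≡ top x xs) →
                    ∀ c xs → c ∷ xs ≡ low c xs ++ [ top c xs ]
    snoc-initLast low top l0 l1 t0 t1 c [] =
      ≡.sym (cong₂ (λ u v → u ++ [ v ]) (l0 c) (t0 c))
    snoc-initLast low top l0 l1 t0 t1 c (x ∷ xs) = ≡.trans
      (cong (c ∷_) (snoc-initLast low top l0 l1 t0 t1 x xs))
      (≡.sym (cong₂ (λ u v → u ++ [ v ]) (l1 c x xs) (t1 c x xs)))

  -- One step of long division: subtracting l times the monic divisor removes the top coefficient l
  -- and changes the lower ones as in `divModMonic`.
  reduce-spec : ∀ l low gs → length low ≡ length gs →
    low ++ [ l ] ≋ l ·P (gs ++ [ 1# ]) +P zipWith (λ u g → u - l * g) low gs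
  reduce-spec l []        []       e = ∷-cong (sym (*-identityʳ l)) ≋-refl
  reduce-spec l (u ∷ low) (g ∷ gs) e =
    ∷-cong (sym (trans (+-comm _ _) (trans (+-assoc _ _ _) (trans (+-congˡ (-‿inverseˡ _)) (+-identityʳ u)))))
           (reduce-spec l low gs (ℕ.suc-injective e))

  length-zipWith-≡ : ∀ {A : Set} (f : A → A → A) xs ys → length xs ≡ length ys →
                     length (zipWith f xs ys) ≡ length ys
  length-zipWith-≡ f []       []       e = ≡.refl
  length-zipWith-≡ f (x ∷ xs) (y ∷ ys) e = cong suc (length-zipWith-≡ f xs ys (ℕ.suc-injective e))

  length-snoc : ∀ {xs ys : List Carrier} {x} → xs ≡ ys ++ [ x ] → length xs ≡ suc (length ys)
  length-snoc {ys = ys} ≡.refl = ≡.trans (length-++ ys) (ℕ.+-comm (length ys) 1)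

  -- The components of initLast, which is private in Defs: unification finds them
  -- in the unfolding of divModMonic.
  mutual
    private
      initLast₁ : Carrier → List Carrier → List Carrier
      initLast₁ = _

      initLast₂ : Carrier → List Carrier → Carrier
      initLast₂ = _

    divModMonic-spec : ∀ gs a → let q , r = divModMonic gs a in
      (a ≋ (gs ++ [ 1# ]) *P q +P r) × length r ≡ length gs
    divModMonic-spec gs [] =
      ≋-sym (+P-cong {b′ = []} (*P-zeroʳ (gs ++ [ 1# ])) (replicate-zero (length gs)))
      , length-replicate (length gs)
      where
      replicate-zero : ∀ n → replicate n 0# ≋ []
      replicate-zero zero    = ≋-refl
      replicate-zero (suc n) = 0∷-zero refl (replicate-zero n)
    divModMonic-spec gs (c ∷ a) with divModMonic gs a | divModMonic-spec gs a
    ... | q , r | e , len =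
      step (snoc-initLast initLast₁ initLast₂
        (λ _ → ≡.refl) (λ _ _ _ → ≡.refl) (λ _ → ≡.refl) (λ _ _ _ → ≡.refl) c r)
      where
      G = gs ++ [ 1# ]
      step : ∀ {low l} → c ∷ r ≡ low ++ [ l ] →
             let r′ = zipWith (λ u g → u - l * g) low gs in
             (c ∷ a ≋ G *P (l ∷ q) +P r′) × length r′ ≡ length gs
      step {low} {l} snoc =
        ≋-trans (∷-cong (sym (+-identityˡ c)) e)
        (≋-trans (+P-cong {a = 0# ∷ G *P q} ≋-refl (≋-trans (≋-reflexive snoc) (reduce-spec l low gs len-low)))
        (≋-trans (≋-sym (+P-assoc (0# ∷ G *P q) (l ·P G) r′))
        (+P-cong {b = r′} (≋-trans (+P-comm (0# ∷ G *P q) (l ·P G)) (≋-sym (*P-∷ G l q))) ≋-refl)))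
        , length-zipWith-≡ _ low gs len-low
        where
        r′ = zipWith (λ u g → u - l * g) low gs
        len-low : length low ≡ length gs
        len-low = ℕ.suc-injective (≡.trans (≡.sym (length-snoc {ys = low} snoc)) (cong suc len))

  lowCoeffs-spec : ∀ {d} g → MonicOfDegree g d → g ≡ lowCoeffs g ++ [ 1# ] × length (lowCoeffs g) ≡ d
  lowCoeffs-spec (x ∷ g) (len , l) =
    ≡.trans snoc (cong (λ t → lowCoeffs (x ∷ g) ++ [ t ]) top≡1)
    , ℕ.suc-injective (≡.trans (≡.sym (length-snoc {ys = lowCoeffs (x ∷ g)} snoc)) len)
    where
    snoc-lowCoeffs : ∀ c xs → ∃ λ t → c ∷ xs ≡ lowCoeffs (c ∷ xs) ++ [ t ]
    snoc-lowCoeffs c []       = c , ≡.refl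
    snoc-lowCoeffs c (y ∷ ys) with snoc-lowCoeffs y ys
    ... | t , eq = t , cong (c ∷_) eq
    last-++ : ∀ ys (t : Carrier) → last (ys ++ [ t ]) ≡ just t
    last-++ []           t = ≡.refl
    last-++ (y ∷ [])     t = ≡.refl
    last-++ (y ∷ z ∷ ys) t = last-++ (z ∷ ys) t
    top = proj₁ (snoc-lowCoeffs x g)
    snoc = proj₂ (snoc-lowCoeffs x g)
    top≡1 : top ≡ 1#
    top≡1 = just-injective (≡.trans (≡.sym (last-++ (lowCoeffs (x ∷ g)) top))
                           (≡.trans (cong last (≡.sym snoc)) l))

  MonicOfDegree⇒MonicList : ∀ {d} g → MonicOfDegree g d → MonicList d g
  MonicOfDegree⇒MonicList g mg with lowCoeffs-spec g mg
  ... | eq , len = ≋-reflexive eq , len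

  MonicList⇒Monic : ∀ {d} g → MonicList d g → Monic d g
  MonicList⇒Monic {d} g (eq , len) with ≡.subst (λ m → Monic m (lowCoeffs g ++ [ 1# ])) len (Monic-++1 (lowCoeffs g))
  ... | below , one = (λ i l → trans (at eq i) (below i l)) , trans (at eq d) one

  -P-DegreeBelow : ∀ {m} a b → DegreeBelow m a → DegreeBelow m b → DegreeBelow m (a -P b)
  -P-DegreeBelow a b ba bb i m≤i = begin
    coef (a -P b) i       ≈⟨ coef-- a b i ⟩
    coef a i - coef b i   ≈⟨ +-cong (ba i m≤i) (-‿cong (bb i m≤i)) ⟩
    0# - 0#               ≈⟨ -‿inverseʳ 0# ⟩
    0#                    ∎

  divide : ∀ {d} g → MonicList d g → ∀ a →
    let r = proj₂ (divModMonic (lowCoeffs g) a) in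
    (a ≋ g *P quotMonic a g +P r) × DegreeBelow d r
  divide g (eq , len) a with divModMonic-spec (lowCoeffs g) a
  ... | e , lenr =
    ≋-trans e (+P-cong (*P-congʳ (quotMonic a g) (≋-sym eq)) ≋-refl)
    , ≡.subst (λ m → DegreeBelow m r) (≡.trans lenr len) (length⇒DegreeBelow r)
    where r = proj₂ (divModMonic (lowCoeffs g) a)

  -- Uniqueness of division: g (c - q) equals the remainder, whose degree is below that of g, so c =
  -- q by `monic-*-cancel`. Through this the computed Fermat quotient becomes usable as soon as some
  -- cofactor of ℘ is known.
  quotMonic-exact : ∀ {d} g → MonicList d g → ∀ {a c} → a ≋ g *P c → quotMonic a g ≋ c
  quotMonic-exact g mg {a} {c} e with divide g mg a
  ... | e′ , br = ≋-sym (-P-zero⇒≋ c Q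
    (monic-*-cancel g (MonicList⇒Monic g mg) (c -P Q) λ i d≤i → trans (at gdiff i) (br i d≤i)))
    where
    open RingProperties (CommutativeRing.ring polyRing) using ()
      renaming (+-cancelˡ to +P-cancelˡ; //-rightDividesˡ to cancel)
    Q = quotMonic a g
    r = proj₂ (divModMonic (lowCoeffs g) a)
    gdiff : g *P (c -P Q) ≋ r
    gdiff = +P-cancelˡ (g *P Q) (g *P (c -P Q)) r
      (≋-trans (≋-sym (*P-distribˡ g Q (c -P Q)))
      (≋-trans (*P-congˡ g (≋-trans (+P-comm Q (c -P Q)) (cancel Q c)))
      (≋-trans (≋-sym e) e′)))

-- Extension of coefficients from F to K

module Map (F K : CommutativeRing 0ℓ 0ℓ)
           (ι : CommutativeRing.Carrier F → CommutativeRing.Carrier K) (hom : IsRingHom F K ι) where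
  open CommutativeRing K
  open Poly K
  open PolyRing K
  open Division K using (MonicList)
  open RingMorphisms.IsRingHomomorphism hom
  private
    module F = CommutativeRing F
    module PF = Poly F
    module RF = PolyRing F
    module DivisionF = Division F

  ιP : PF.P → P
  ιP = map ι

  coef-ι : ∀ a n → coef (ιP a) n ≈ ι (RF.coef a n)
  coef-ι []      n       = sym 0#-homo
  coef-ι (c ∷ a) zero    = refl
  coef-ι (c ∷ a) (suc n) = coef-ι a n

  ι-congP : ∀ {a b} → a RF.≋ b → ιP a ≋ ιP b
  ι-congP {a} {b} e = coefwise λ n →
    trans (coef-ι a n) (trans (⟦⟧-cong (RF.at e n)) (sym (coef-ι b n)))

  ι-+ : ∀ a b → ιP (a PF.+P b) ≋ ιP a +P ιP b
  ι-+ []      b       = ≋-refl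
  ι-+ (c ∷ a) []      = ≋-refl
  ι-+ (c ∷ a) (d ∷ b) = ∷-cong (+-homo c d) (ι-+ a b)

  ι-· : ∀ c a → ιP (c PF.·P a) ≋ ι c ·P ιP a
  ι-· c []      = ≋-refl
  ι-· c (d ∷ a) = ∷-cong (*-homo c d) (ι-· c a)

  ι-neg : ∀ a → ιP (PF.-P a) ≋ -P ιP a
  ι-neg []      = ≋-refl
  ι-neg (d ∷ a) = ∷-cong (-‿homo d) (ι-neg a)

  ι-sub : ∀ a b → ιP (a PF.-P b) ≋ ιP a -P ιP b
  ι-sub a b = ≋-trans (ι-+ a (PF.-P b)) (+P-cong (≋-refl {ιP a}) (ι-neg b))

  ι-* : ∀ a b → ιP (a PF.*P b) ≋ ιP a *P ιP b
  ι-* []      b = ≋-refl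
  ι-* (c ∷ a) b = ≋-trans (ι-+ (c PF.·P b) (F.0# ∷ a PF.*P b))
    (+P-cong (ι-· c b) (∷-cong 0#-homo (ι-* a b)))

  ι-oneP : ιP PF.oneP ≋ oneP
  ι-oneP = ∷-cong 1#-homo ≋-refl

  ι-X : ιP PF.X ≋ X
  ι-X = ∷-cong 0#-homo ι-oneP

  ι-^ : ∀ a n → ιP (a PF.^P n) ≋ ιP a ^P n
  ι-^ a zero    = ι-oneP
  ι-^ a (suc n) = ≋-trans (ι-* a (a PF.^P n)) (*P-congˡ (ιP a) (ι-^ a n))

  ι-deriv : ∀ a → ιP (PF.deriv a) ≋ deriv (ιP a)
  ι-deriv []      = ≋-refl
  ι-deriv (c ∷ a) = ≋-trans (ι-+ a (F.0# ∷ PF.deriv a))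
    (+P-cong (≋-refl {ιP a}) (∷-cong 0#-homo (ι-deriv a)))

  ι-MonicList : ∀ {d} g → 0 ≢ length g → DivisionF.MonicList d g → MonicList d (ιP g)
  ι-MonicList []      0≢  _          = contradiction ≡.refl 0≢
  ι-MonicList (x ∷ g) _   (eq , len) =
    ≋-trans (ι-congP eq) (≋-trans (≋-reflexive (map-++ ι (PF.lowCoeffs (x ∷ g)) _))
      (≋-trans (++-cong (map ι (PF.lowCoeffs (x ∷ g))) ι-oneP)
               (≋-reflexive (cong (_++ oneP) (≡.sym (lowCoeffs-ι x g))))))
    , ≡.trans (cong length (lowCoeffs-ι x g)) (≡.trans (length-map ι (PF.lowCoeffs (x ∷ g))) len)
    where
    lowCoeffs-ι : ∀ x g → lowCoeffs (map ι (x ∷ g)) ≡ map ι (PF.lowCoeffs (x ∷ g))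
    lowCoeffs-ι x []      = ≡.refl
    lowCoeffs-ι x (y ∷ g) = cong (ι x ∷_) (lowCoeffs-ι y g)
    ++-cong : ∀ a {b c} → b ≋ c → a ++ b ≋ a ++ c
    ++-cong []      e = e
    ++-cong (x ∷ a) e = ∷-cong refl (++-cong a e)

module SumSingle (M : CommutativeMonoid 0ℓ 0ℓ) where
  open CommutativeMonoid M
  open MonoidSum M

  sum-ε : ∀ {n} (t : Fin n → Carrier) → (∀ j → t j ≈ ε) → sum t ≈ ε
  sum-ε {n} t e = trans (sum-cong-≋ e) (sum-replicate-zero n)

  sum-single : ∀ {n} (i : Fin n) (t : Fin n → Carrier) →
               (∀ j → j ≢ i → t j ≈ ε) → sum t ≈ t i
  sum-single zero    t e =
    trans (∙-congˡ (sum-ε (t ∘ suc) λ j → e (suc j) λ ())) (identityʳ _)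
  sum-single (suc i) t e =
    trans (∙-cong (e zero λ ()) (sum-single i (t ∘ suc) λ j j≢i → e (suc j) (j≢i ∘ Fin.suc-injective)))
          (identityˡ _)

-- Finite fields: inverses, sums and products over all elements, the theorems of Wilson and Fermat

module FiniteField (K : CommutativeRing 0ℓ 0ℓ) (K-field : IsField K) {N : ℕ} (S : HasSize K N) where
  open CommutativeRing K
  open HasSize S
  open RingProperties ring
  open SemiringExp semiring using () renaming (_^_ to _^ᴿ_)
  open SemiringMult semiring using () renaming (_×_ to _⨯_)
  open SetoidReasoning setoid
  open SemigroupProperties *-commutativeSemigroup using (x∙yz≈yx∙z)

  index : Carrier → Fin N
  index x = proj₁ (surj x)

  enum-index : ∀ x → enum (index x) ≈ x
  enum-index x = proj₂ (surj x)

  index-cong : ∀ {x y} → x ≈ y → index x ≡ index y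
  index-cong {x} {y} e = inj _ _ (trans (enum-index x) (trans e (sym (enum-index y))))

  index-injective : ∀ {x y} → index x ≡ index y → x ≈ y
  index-injective {x} {y} e =
    trans (sym (enum-index x)) (trans (reflexive (cong enum e)) (enum-index y))

  index-enum : ∀ i → index (enum i) ≡ i
  index-enum i = inj _ _ (enum-index (enum i))

  infix 4 _≟_
  _≟_ : ∀ x y → Dec (x ≈ y)
  x ≟ y = map′ index-injective index-cong (index x Fin.≟ index y)

  1≉0 : ¬ 1# ≈ 0#
  1≉0 = proj₁ K-field

  *-cancelˡ-nonZero : ∀ {x y z} → ¬ x ≈ 0# → x * y ≈ x * z → y ≈ z
  *-cancelˡ-nonZero {x} {y} {z} x≉0 e with proj₂ K-field x x≉0
  ... | x⁻¹ , xx⁻¹≈1 = begin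
    y               ≈⟨ lemma y ⟨
    x⁻¹ * (x * y)   ≈⟨ *-congˡ e ⟩
    x⁻¹ * (x * z)   ≈⟨ lemma z ⟩
    z               ∎
    where
    lemma : ∀ y → x⁻¹ * (x * y) ≈ y
    lemma y = begin
      x⁻¹ * (x * y)   ≈⟨ *-assoc _ _ _ ⟨
      x⁻¹ * x * y     ≈⟨ *-congʳ (trans (*-comm _ _) xx⁻¹≈1) ⟩
      1# * y          ≈⟨ *-identityˡ y ⟩
      y               ∎

  integral : ∀ {x y} → ¬ x ≈ 0# → x * y ≈ 0# → y ≈ 0#
  integral {x} x≉0 e = *-cancelˡ-nonZero x≉0 (trans e (sym (zeroʳ x)))

  *-nonZero : ∀ {x y} → ¬ x ≈ 0# → ¬ y ≈ 0# → ¬ x * y ≈ 0#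
  *-nonZero x≉0 y≉0 = y≉0 ∘ integral x≉0

  factor-nonZeroˡ : ∀ {x y} → ¬ x * y ≈ 0# → ¬ x ≈ 0#
  factor-nonZeroˡ xy≉0 x≈0 = xy≉0 (trans (*-congʳ x≈0) (zeroˡ _))

  factor-nonZeroʳ : ∀ {x y} → ¬ x * y ≈ 0# → ¬ y ≈ 0#
  factor-nonZeroʳ xy≉0 y≈0 = xy≉0 (trans (*-congˡ y≈0) (zeroʳ _))

  -1≉0 : ¬ - 1# ≈ 0#
  -1≉0 e = 1≉0 (trans (sym (-‿involutive 1#)) (trans (-‿cong e) -0#≈0#))

  infix 8 _⁻¹
  -- Made total by 0⁻¹ = 0, so that a sum of terms divided by x may run over the whole field, the
  -- term at 0 being zero.
  _⁻¹ : Carrier → Carrier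
  x ⁻¹ with x ≟ 0#
  ... | yes _   = 0#
  ... | no  x≉0 = proj₁ (proj₂ K-field x x≉0)

  0⁻¹ : ∀ {x} → x ≈ 0# → x ⁻¹ ≈ 0#
  0⁻¹ {x} e with x ≟ 0#
  ... | yes _ = refl
  ... | no  n = contradiction e n

  *-⁻¹ : ∀ {x} → ¬ x ≈ 0# → x * x ⁻¹ ≈ 1#
  *-⁻¹ {x} n with x ≟ 0#
  ... | yes e = contradiction e n
  ... | no  m = proj₂ (proj₂ K-field x m)

  ⁻¹-unique : ∀ {x y} → x * y ≈ 1# → y ≈ x ⁻¹
  ⁻¹-unique {x} e = *-cancelˡ-nonZero x≉0 (trans e (sym (*-⁻¹ x≉0)))
    where
    x≉0 : ¬ x ≈ 0#
    x≉0 = factor-nonZeroˡ λ f → 1≉0 (trans (sym e) f)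

  ⁻¹-cong : ∀ {x y} → x ≈ y → x ⁻¹ ≈ y ⁻¹
  ⁻¹-cong {x} {y} e with x ≟ 0#
  ... | yes x≈0 = sym (0⁻¹ (trans (sym e) x≈0))
  ... | no  x≉0 = ⁻¹-unique (trans (*-congʳ (sym e)) (proj₂ (proj₂ K-field x x≉0)))

  ⁻¹-involutive : ∀ x → (x ⁻¹) ⁻¹ ≈ x
  ⁻¹-involutive x with x ≟ 0#
  ... | yes x≈0 = trans (0⁻¹ refl) (sym x≈0)
  ... | no  x≉0 = sym (⁻¹-unique (trans (*-comm _ _) (proj₂ (proj₂ K-field x x≉0))))

  -- For y = 0 both sides are 0 by the convention on inverses; hence sums over the whole field can
  -- be rescaled without excluding 0.
  ⁻¹-* : ∀ {x y} → ¬ x ≈ 0# → x * (x * y) ⁻¹ ≈ y ⁻¹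
  ⁻¹-* {x} {y} x≉0 with y ≟ 0#
  ... | yes y≈0 = trans (*-congˡ (0⁻¹ (trans (*-congˡ y≈0) (zeroʳ x)))) (zeroʳ x)
  ... | no  y≉0 = *-cancelˡ-nonZero y≉0 (begin
    y * (x * (x * y) ⁻¹)                    ≈⟨ x∙yz≈yx∙z y x _ ⟩
    x * y * (x * y) ⁻¹                      ≈⟨ *-⁻¹ (*-nonZero x≉0 y≉0) ⟩
    1#                                      ≈⟨ proj₂ (proj₂ K-field y y≉0) ⟨
    y * proj₁ (proj₂ K-field y y≉0)         ∎)

  -- Sends 0 to 1, so that a product of nonZeroPart over K is a product over K*.
  nonZeroPart : Carrier → Carrier
  nonZeroPart x with x ≟ 0#
  ... | yes _ = 1#
  ... | no  _ = x

  nonZeroPart-zero : ∀ {x} → x ≈ 0# → nonZeroPart x ≈ 1#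
  nonZeroPart-zero {x} e with x ≟ 0#
  ... | yes _ = refl
  ... | no  n = contradiction e n

  nonZeroPart-nonZero : ∀ {x} → ¬ x ≈ 0# → nonZeroPart x ≈ x
  nonZeroPart-nonZero {x} n with x ≟ 0#
  ... | yes e = contradiction e n
  ... | no  _ = refl

  nonZeroPart-cong : ∀ {x y} → x ≈ y → nonZeroPart x ≈ nonZeroPart y
  nonZeroPart-cong {x} {y} e with x ≟ 0#
  ... | yes x≈0 = sym (nonZeroPart-zero (trans (sym e) x≈0))
  ... | no  x≉0 = trans e (sym (nonZeroPart-nonZero (x≉0 ∘ trans e)))

  module Sums (M : CommutativeMonoid 0ℓ 0ℓ) where
    private module M = CommutativeMonoid M
    open MonoidSum M public

    reindex : ∀ (f g : Carrier → Carrier) →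
              (∀ {x y} → x ≈ y → f x ≈ f y) → (∀ {x y} → x ≈ y → g x ≈ g y) →
              (∀ x → f (g x) ≈ x) → (∀ x → g (f x) ≈ x) →
              (h : Carrier → M.Carrier) → (∀ {x y} → x ≈ y → h x M.≈ h y) →
              sum (h ∘ enum) M.≈ sum (h ∘ f ∘ enum)
    reindex f g f-cong g-cong fg gf h h-cong = M.trans
      (sum-permute (h ∘ enum) (permutation (index ∘ f ∘ enum) (index ∘ g ∘ enum)
        (inverse f g f-cong fg) (inverse g f g-cong gf)))
      (sum-cong-≋ λ i → h-cong (enum-index (f (enum i))))
      where
      inverse : ∀ f g → (∀ {x y} → x ≈ y → f x ≈ f y) → (∀ x → f (g x) ≈ x) →
                ∀ i → index (f (enum (index (g (enum i))))) ≡ i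
      inverse f g f-cong fg i = ≡.trans
        (index-cong (trans (f-cong (enum-index _)) (fg (enum i)))) (index-enum i)

    sum-at : ∀ a (h : Carrier → M.Carrier) {u} → (∀ {x} → x ≈ a → h x M.≈ u) →
             (∀ {x} → ¬ x ≈ a → h x M.≈ M.ε) → sum (h ∘ enum) M.≈ u
    sum-at a h e n = M.trans
      (SumSingle.sum-single M (index a) (h ∘ enum) λ j j≢a →
        n λ f → j≢a (≡.trans (≡.sym (index-enum j)) (index-cong f)))
      (e (enum-index a))

  module Σ = Sums +-commutativeMonoid
  module Π = Sums *-commutativeMonoid

  -- Translation by 1 permutes the elements, so adding `N ⨯ 1#` to their sum leaves it unchanged.
  size⨯1≈0 : N ⨯ 1# ≈ 0#
  size⨯1≈0 = +-cancelˡ (Σ.sum enum) _ _ (begin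
    Σ.sum enum + N ⨯ 1#                    ≈⟨ +-congˡ (Σ.sum-replicate N) ⟨
    Σ.sum enum + Σ.sum {N} (λ _ → 1#)      ≈⟨ Σ.∑-distrib-+ enum (λ _ → 1#) ⟨
    Σ.sum (λ i → enum i + 1#)              ≈⟨ Σ.reindex (_+ 1#) (_- 1#) +-congʳ +-congʳ
                                              (//-rightDividesˡ 1#) (//-rightDividesʳ 1#) (λ x → x) (λ e → e) ⟨
    Σ.sum enum                             ≈⟨ +-identityʳ _ ⟨
    Σ.sum enum + 0#                        ∎)

  -- If 1 + 1 = 0, dropping pairs of ones from `N ⨯ 1#` leaves 1 when N is odd, against `size⨯1≈0`.
  odd-size⇒2≉0 : ¬ 2 ∣ N → ¬ 1# + 1# ≈ 0#
  odd-size⇒2≉0 2∤N 2≈0 = 1≉0 (trans (sym (odd⨯1 N 2∤N)) size⨯1≈0)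
    where
    odd⨯1 : ∀ n → ¬ 2 ∣ n → n ⨯ 1# ≈ 1#
    odd⨯1 zero          2∤n = contradiction (2 ∣0) 2∤n
    odd⨯1 (suc zero)    2∤n = +-identityʳ 1#
    odd⨯1 (suc (suc n)) 2∤n = trans (sym (+-assoc _ _ _))
      (trans (+-congʳ 2≈0) (trans (+-identityˡ _) (odd⨯1 n (2∤n ∘ ∣m∣n⇒∣m+n ∣-refl))))

  ifZero : Carrier → Carrier → Carrier → Carrier
  ifZero u v x with x ≟ 0#
  ... | yes _ = u
  ... | no  _ = v

  ifZero-zero : ∀ {u v x} → x ≈ 0# → ifZero u v x ≈ u
  ifZero-zero {x = x} e with x ≟ 0#
  ... | yes _ = refl
  ... | no  n = contradiction e n

  ifZero-nonZero : ∀ {u v x} → ¬ x ≈ 0# → ifZero u v x ≈ v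
  ifZero-nonZero {x = x} n with x ≟ 0#
  ... | yes e = contradiction e n
  ... | no  _ = refl

  -- Every nonzero element contributes 1 and zero contributes 0. Supplying the missing 1 at zero
  -- completes the sum to `N ⨯ 1#`, which vanishes.
  sum-*-⁻¹ : Σ.sum (λ i → enum i * enum i ⁻¹) ≈ - 1#
  sum-*-⁻¹ = +-inverseˡ-unique _ _ (begin
    Σ.sum (λ i → enum i * enum i ⁻¹) + 1#
      ≈⟨ +-congˡ (Σ.sum-at 0# (ifZero 1# 0#) ifZero-zero ifZero-nonZero) ⟨
    Σ.sum (λ i → enum i * enum i ⁻¹) + Σ.sum (ifZero 1# 0# ∘ enum)
      ≈⟨ Σ.∑-distrib-+ (λ i → enum i * enum i ⁻¹) (ifZero 1# 0# ∘ enum) ⟨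
    Σ.sum (λ i → enum i * enum i ⁻¹ + ifZero 1# 0# (enum i))
      ≈⟨ Σ.sum-cong-≋ (λ i → lemma (enum i)) ⟩
    Σ.sum {N} (λ _ → 1#)
      ≈⟨ Σ.sum-replicate N ⟩
    N ⨯ 1#
      ≈⟨ size⨯1≈0 ⟩
    0# ∎)
    where
    lemma : ∀ x → x * x ⁻¹ + ifZero 1# 0# x ≈ 1#
    lemma x with x ≟ 0#
    ... | yes x≈0 = trans (+-congʳ (zeroʳ x)) (+-identityˡ 1#)
    ... | no  x≉0 = trans (+-congʳ (proj₂ (proj₂ K-field x x≉0))) (+-identityʳ 1#)

  -- The factors x and x⁻¹ cancel: L collects the indices i with i < i⁻¹, G those with i > i⁻¹,
  -- and E those with i = i⁻¹, which belong to 0, 1 and −1.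
  wilson : Π.sum (nonZeroPart ∘ enum) ≈ - 1#
  wilson = begin
    Π.sum y                                       ≈⟨ Π.sum-cong-≋ y≈LGE ⟩
    Π.sum (λ i → L i * G i * E i)                 ≈⟨ Π.∑-distrib-+ (λ i → L i * G i) E ⟩
    Π.sum (λ i → L i * G i) * Π.sum E             ≈⟨ *-cong ΠLG≈1 ΠE≈-1 ⟩
    1# * - 1#                                     ≈⟨ *-identityˡ _ ⟩
    - 1#                                          ∎
    where
    y : Fin N → Carrier
    y = nonZeroPart ∘ enum
    inverse : Fin N → Fin N
    inverse i = index (enum i ⁻¹)
    inverse-involutive : ∀ i → inverse (inverse i) ≡ i
    inverse-involutive i = ≡.trans
      (index-cong (trans (⁻¹-cong (enum-index _)) (⁻¹-involutive (enum i)))) (index-enum i)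
    case : ∀ {i j : Fin N} → Tri (i < j) (i ≡ j) (j < i) → (u v w : Carrier) → Carrier
    case (tri< _ _ _) u v w = u
    case (tri≈ _ _ _) u v w = v
    case (tri> _ _ _) u v w = w
    cmp : ∀ i j → Tri (i < j) (i ≡ j) (j < i)
    cmp = Fin.<-cmp
    L E G : Fin N → Carrier
    L i = case (cmp i (inverse i)) (y i) 1# 1#
    E i = case (cmp i (inverse i)) 1# (y i) 1#
    G i = case (cmp i (inverse i)) 1# 1# (y i)
    y≈LGE : ∀ i → y i ≈ L i * G i * E i
    y≈LGE i with cmp i (inverse i)
    ... | tri< _ _ _ = sym (trans (*-identityʳ _) (*-identityʳ _))
    ... | tri≈ _ _ _ = sym (trans (*-congʳ (*-identityʳ _)) (*-identityˡ _))
    ... | tri> _ _ _ = sym (trans (*-identityʳ _) (*-identityˡ _))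
    y-inverse : ∀ x → nonZeroPart x * nonZeroPart (x ⁻¹) ≈ 1#
    y-inverse x with x ≟ 0#
    ... | yes x≈0 = trans (*-identityˡ _) (nonZeroPart-zero refl)
    ... | no  x≉0 = trans (*-congˡ (nonZeroPart-nonZero (factor-nonZeroʳ λ e → 1≉0 (trans (sym e′) e)))) e′
      where e′ = proj₂ (proj₂ K-field x x≉0)
    -- Inversion reverses the comparison: i lies in L exactly if its inverse lies in G. So either
    -- both factors are 1 or they are x and x⁻¹; the mixed outcomes of the two comparisons are
    -- contradictory.
    LG≈1 : ∀ i → L i * G (inverse i) ≈ 1#
    LG≈1 i with cmp i (inverse i) | cmp (inverse i) (inverse (inverse i)) | inverse-involutive i
    ... | tri< _ _ _ | tri> _ _ _ | _ =
      trans (*-congˡ (nonZeroPart-cong (enum-index _))) (y-inverse (enum i))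
    ... | tri< l _ _ | tri< _ _ n | e = contradiction (≡.subst (_< inverse i) (≡.sym e) l) n
    ... | tri< l _ _ | tri≈ _ _ n | e = contradiction (≡.subst (_< inverse i) (≡.sym e) l) n
    ... | tri≈ n _ _ | tri> _ _ l | e = contradiction (≡.subst (_< inverse i) e l) n
    ... | tri> n _ _ | tri> _ _ l | e = contradiction (≡.subst (_< inverse i) e l) n
    ... | tri≈ _ _ _ | tri< _ _ _ | _ = *-identityˡ 1#
    ... | tri≈ _ _ _ | tri≈ _ _ _ | _ = *-identityˡ 1#
    ... | tri> _ _ _ | tri< _ _ _ | _ = *-identityˡ 1#
    ... | tri> _ _ _ | tri≈ _ _ _ | _ = *-identityˡ 1#
    ΠLG≈1 : Π.sum (λ i → L i * G i) ≈ 1#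
    ΠLG≈1 = begin
      Π.sum (λ i → L i * G i)              ≈⟨ Π.∑-distrib-+ L G ⟩
      Π.sum L * Π.sum G                    ≈⟨ *-congˡ (Π.sum-permute G
                                               (permutation inverse inverse inverse-involutive inverse-involutive)) ⟩
      Π.sum L * Π.sum (G ∘ inverse)        ≈⟨ Π.∑-distrib-+ L (G ∘ inverse) ⟨
      Π.sum (λ i → L i * G (inverse i))    ≈⟨ SumSingle.sum-ε *-commutativeMonoid _ LG≈1 ⟩
      1#                                   ∎
    j = index (- 1#)
    -1*-1≈1 : - 1# * - 1# ≈ 1#
    -1*-1≈1 = trans (-1*x≈-x (- 1#)) (-‿involutive 1#)
    E-at-1 : E j ≈ - 1#
    E-at-1 with cmp j (inverse j)
    ... | tri≈ _ _ _ = trans (nonZeroPart-nonZero (-1≉0 ∘ trans (sym (enum-index _)))) (enum-index _)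
    ... | tri< _ n _ = contradiction j≡ n
      where
      j≡ : j ≡ inverse j
      j≡ = index-cong (⁻¹-unique (trans (*-congʳ (enum-index _)) -1*-1≈1))
    ... | tri> _ n _ = contradiction j≡ n
      where
      j≡ : j ≡ inverse j
      j≡ = index-cong (⁻¹-unique (trans (*-congʳ (enum-index _)) -1*-1≈1))
    E-away : ∀ i → i ≢ j → E i ≈ 1#
    E-away i i≢j with cmp i (inverse i)
    ... | tri< _ _ _ = refl
    ... | tri> _ _ _ = refl
    ... | tri≈ _ e _ = helper (enum i) (trans (reflexive (cong enum e)) (enum-index _))
          (λ f → i≢j (≡.trans (≡.sym (index-enum i)) (index-cong f)))
      where
      -- A nonzero x equal to its inverse satisfies x² = 1, hence (x + 1) x = x + 1, and x + 1 may
      -- be cancelled as x is not -1.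
      helper : ∀ x → x ≈ x ⁻¹ → ¬ x ≈ - 1# → nonZeroPart x ≈ 1#
      helper x e n with x ≟ 0# 
      ... | yes _ = refl
      ... | no  x≉0 = x≈1
        where
        xx≈1 : x * x ≈ 1#
        xx≈1 = trans (*-congˡ e) (proj₂ (proj₂ K-field x x≉0))
        x+1≉0 : ¬ x + 1# ≈ 0#
        x+1≉0 f = n (+-inverseˡ-unique x 1# f)
        x≈1 : x ≈ 1#
        x≈1 = *-cancelˡ-nonZero x+1≉0 (begin
          (x + 1#) * x       ≈⟨ distribʳ x x 1# ⟩
          x * x + 1# * x     ≈⟨ +-cong xx≈1 (*-identityˡ x) ⟩
          1# + x             ≈⟨ +-comm 1# x ⟩
          x + 1#             ≈⟨ *-identityʳ _ ⟨
          (x + 1#) * 1#      ∎)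
    ΠE≈-1 : Π.sum E ≈ - 1#
    ΠE≈-1 = trans (SumSingle.sum-single *-commutativeMonoid j E E-away) E-at-1

  -- Multiplication by u ≠ 0 permutes the nonzero elements, so it multiplies their product by one u
  -- for each of them and yet preserves it. That product is -1 by `wilson` and can be cancelled, so
  -- these N - 1 factors u multiply to 1; the one remaining factor, placed at the index of 0, is u
  -- itself.
  fermat : ∀ x → x ^ᴿ N ≈ x
  fermat u with u ≟ 0#
  -- That 0^N is 0 requires N > 0; the element `index u` of `Fin N` witnesses this.
  ... | yes u≈0 = 0^ (index u)
    where
    0^ : ∀ {n} → Fin n → u ^ᴿ n ≈ u
    0^ {suc n} _ = trans (*-congʳ u≈0) (trans (zeroˡ _) (sym u≈0))
  ... | no  u≉0 = begin
    u ^ᴿ N                             ≈⟨ Π.sum-replicate N ⟨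
    Π.sum {N} (λ _ → u)               ≈⟨ Π.sum-cong-≋ (λ i → lemma (enum i)) ⟩
    Π.sum (λ i → ifZero 1# u (enum i) * ifZero u 1# (enum i))
      ≈⟨ Π.∑-distrib-+ (ifZero 1# u ∘ enum) (ifZero u 1# ∘ enum) ⟩
    Π.sum (ifZero 1# u ∘ enum) * Π.sum (ifZero u 1# ∘ enum)
      ≈⟨ *-cong ΠC≈1 (Π.sum-at 0# (ifZero u 1#) ifZero-zero ifZero-nonZero) ⟩
    1# * u                            ≈⟨ *-identityˡ u ⟩
    u                                 ∎
    where
    lemma : ∀ x → u ≈ ifZero 1# u x * ifZero u 1# x
    lemma x with x ≟ 0#
    ... | yes _ = sym (*-identityˡ u)
    ... | no  _ = sym (*-identityʳ u)
    nonZeroPart-* : ∀ x → nonZeroPart (u * x) ≈ nonZeroPart x * ifZero 1# u x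
    nonZeroPart-* x with x ≟ 0#
    ... | yes x≈0 = trans (nonZeroPart-zero (trans (*-congˡ x≈0) (zeroʳ u))) (sym (*-identityˡ 1#))
    ... | no  x≉0 = trans (nonZeroPart-nonZero (*-nonZero u≉0 x≉0)) (*-comm u x)
    u*u⁻¹* : ∀ {u v} → u * v ≈ 1# → ∀ x → u * (v * x) ≈ x
    u*u⁻¹* e x = trans (sym (*-assoc _ _ x)) (trans (*-congʳ e) (*-identityˡ x))
    ΠC≈1 : Π.sum (ifZero 1# u ∘ enum) ≈ 1#
    ΠC≈1 = *-cancelˡ-nonZero -1≉0 (begin
      - 1# * Π.sum (ifZero 1# u ∘ enum)
        ≈⟨ *-congʳ wilson ⟨
      Π.sum (nonZeroPart ∘ enum) * Π.sum (ifZero 1# u ∘ enum)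
        ≈⟨ Π.∑-distrib-+ (nonZeroPart ∘ enum) (ifZero 1# u ∘ enum) ⟨
      Π.sum (λ i → nonZeroPart (enum i) * ifZero 1# u (enum i))
        ≈⟨ Π.sum-cong-≋ (λ i → nonZeroPart-* (enum i)) ⟨
      Π.sum (λ i → nonZeroPart (u * enum i))
        ≈⟨ Π.reindex (u *_) (u ⁻¹ *_) *-congˡ *-congˡ (u*u⁻¹* (*-⁻¹ u≉0))
             (u*u⁻¹* (trans (*-comm _ _) (*-⁻¹ u≉0))) nonZeroPart nonZeroPart-cong ⟨
      Π.sum (nonZeroPart ∘ enum)
        ≈⟨ wilson ⟩
      - 1#
        ≈⟨ *-identityʳ _ ⟨
      - 1# * 1# ∎)

-- Enumeration of coefficient vectors and bijections by counting

allVecs-product : ∀ q d → allVecs q (suc d) ≡ cartesianProductWith _∷_ (allFin q) (allVecs q d)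
allVecs-product q d = go (allFin q)
  where
  go : ∀ is → concatMap (λ i → map (i ∷_) (allVecs q d)) is ≡ cartesianProductWith _∷_ is (allVecs q d)
  go []       = ≡.refl
  go (i ∷ is) = cong (map (i ∷_) (allVecs q d) ++_) (go is)

allVecs-unique : ∀ q d → Unique (allVecs q d)
allVecs-unique q zero    = All.[] ∷ []
allVecs-unique q (suc d) = ≡.subst Unique (≡.sym (allVecs-product q d))
  (cartesianProductWith⁺ _∷_ Vec.∷-injective (allFin⁺ q) (allVecs-unique q d))

∈-allVecs : ∀ {q d} (v : Vec (Fin q) d) → v ∈ allVecs q d
∈-allVecs         []      = here ≡.refl
∈-allVecs {q} {suc d} (i ∷ v) = ≡.subst ((i ∷ v) ∈_) (≡.sym (allVecs-product q d))
  (∈-cartesianProductWith⁺ _∷_ (∈-allFin i) (∈-allVecs v))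

length-cartesianProductWith : ∀ {A B C : Set} (f : A → B → C) xs ys →
                              length (cartesianProductWith f xs ys) ≡ length xs ℕ.* length ys
length-cartesianProductWith f []       ys = ≡.refl
length-cartesianProductWith f (x ∷ xs) ys = ≡.trans (length-++ (map (f x) ys))
  (cong₂ ℕ._+_ (length-map (f x) ys) (length-cartesianProductWith f xs ys))

length-allVecs : ∀ q d → length (allVecs q d) ≡ q ℕ.^ d
length-allVecs q zero    = ≡.refl
length-allVecs q (suc d) = ≡.trans (cong length (allVecs-product q d))
  (≡.trans (length-cartesianProductWith _∷_ (allFin q) (allVecs q d))
         (cong₂ ℕ._*_ (length-tabulate {n = q} id) (length-allVecs q d)))

lookup-unique : ∀ {A : Set} {xs : List A} → Unique xs → ∀ {i j} → lookup xs i ≡ lookup xs j → i ≡ j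
lookup-unique (_ ∷ _)  {Fin.zero}  {Fin.zero}  e = ≡.refl
lookup-unique (x ∷ _)  {Fin.zero}  {Fin.suc j} e = contradiction e (All.lookup x (∈-lookup j))
lookup-unique (x ∷ _)  {Fin.suc i} {Fin.zero}  e = contradiction (≡.sym e) (All.lookup x (∈-lookup i))
lookup-unique (_ ∷ us) {Fin.suc i} {Fin.suc j} e = cong Fin.suc (lookup-unique us e)

-- Pigeonhole: a missing i put in front of the list would give n + 1 distinct elements of `Fin n`.
unique-exhausts : ∀ {n} (xs : List (Fin n)) → Unique xs → length xs ≡ n → ∀ i → i ∈ xs
unique-exhausts {n} xs u len i with i ∈? xs
  where open DecMembership (Fin._≟_ {n})
... | yes i∈xs = i∈xs
... | no  i∉xs = contradiction
  (Fin.injective⇒≤ {f = lookup (i ∷ xs)} (lookup-unique (All.tabulate (λ { x∈xs ≡.refl → i∉xs x∈xs }) ∷ u)))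
  (λ le → ℕ.1+n≰n (ℕ.≤-trans (ℕ.≤-reflexive (cong suc (≡.sym len))) le))

unique-↭ : ∀ {A : Set} {xs ys : List A} → Unique xs → Unique ys →
           (∀ x → x ∈ xs) → (∀ x → x ∈ ys) → xs ↭ ys
unique-↭ ux uy x∈ y∈ = ∼bag⇒↭ (unique∧set⇒bag ux uy λ {x} → mk⇔ (λ _ → y∈ x) (λ _ → x∈ x))

module Fold (M : CommutativeMonoid 0ℓ 0ℓ) where
  private module M = CommutativeMonoid M
  open MonoidSum M using (sum)
  open SemigroupProperties M.commutativeSemigroup using (x∙yz≈y∙xz)

  fold : ∀ {A : Set} → (A → M.Carrier) → List A → M.Carrier
  fold f = foldr (λ x acc → f x M.∙ acc) M.ε

  fold-↭ : ∀ {A : Set} (f : A → M.Carrier) {xs ys} → xs ↭ ys → fold f xs M.≈ fold f ys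
  fold-↭ f ↭.refl         = M.refl
  fold-↭ f (↭.prep x p)   = M.∙-congˡ (fold-↭ f p)
  fold-↭ f (↭.swap x y p) = M.trans (x∙yz≈y∙xz _ _ _) (M.∙-congˡ (M.∙-congˡ (fold-↭ f p)))
  fold-↭ f (↭.trans p r)  = M.trans (fold-↭ f p) (fold-↭ f r)

  fold-tabulate : ∀ {A B : Set} (f : B → M.Carrier) (g : A → B) {n} (h : Fin n → A) →
                  fold f (map g (tabulate h)) ≡ sum (f ∘ g ∘ h)
  fold-tabulate f g {zero}  h = ≡.refl
  fold-tabulate f g {suc n} h = cong (f (g (h Fin.zero)) M.∙_) (fold-tabulate f g (h ∘ Fin.suc))

-- An injective code Vec (Fin q) d → Fin (q ℕ.^ d) is bijective by counting.
module Decode {q d} (code : Vec (Fin q) d → Fin (q ℕ.^ d))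
              (code-injective : ∀ {v w} → code v ≡ code w → v ≡ w) where

  private
    code-surjective : ∀ i → ∃ λ v → v ∈ allVecs q d × i ≡ code v
    code-surjective i = ∈-map⁻ code (unique-exhausts (map code (allVecs q d))
      (map⁺ code-injective (allVecs-unique q d))
      (≡.trans (length-map code (allVecs q d)) (length-allVecs q d)) i)

  decode : Fin (q ℕ.^ d) → Vec (Fin q) d
  decode i = proj₁ (code-surjective i)

  code-decode : ∀ i → code (decode i) ≡ i
  code-decode i = ≡.sym (proj₂ (proj₂ (code-surjective i)))

  -- Turns a commutative fold over coefficient vectors, such as the product defining F_d, into a sum
  -- or product over the indices of K.
  allVecs-↭ : allVecs q d ↭ map decode (allFin (q ℕ.^ d))
  allVecs-↭ = unique-↭ (allVecs-unique q d) (map⁺ decode-injective (allFin⁺ (q ℕ.^ d))) ∈-allVecs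
    λ v → ≡.subst (_∈ _) (code-injective (code-decode (code v))) (∈-map⁺ decode (∈-allFin (code v)))
    where
    decode-injective : ∀ {i j} → decode i ≡ decode j → i ≡ j
    decode-injective {i} {j} e = ≡.trans (≡.sym (code-decode i)) (≡.trans (cong code e) (code-decode j))

-- ℘ as the minimal polynomial of θ over F

module MinimalPolynomial
  (F K : CommutativeRing 0ℓ 0ℓ) (F-field : IsField F) (K-field : IsField K)
  {q} (SF : HasSize F q)
  (ι : CommutativeRing.Carrier F → CommutativeRing.Carrier K) (hom : IsRingHom F K ι)
  {d} (℘ : Poly.P F) (℘-monic : Poly.MonicOfDegree F ℘ d) (℘-irreducible : Poly.Irreducible F ℘)
  (θ : CommutativeRing.Carrier K)
  (℘[θ]≈0 : CommutativeRing._≈_ K (Poly.eval K (List.map ι ℘) θ) (CommutativeRing.0# K))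
  where

  private
    module F = CommutativeRing F
    module K = CommutativeRing K
    module FF = FiniteField F F-field SF
    module EK = Poly K
    module RK = PolyRing K
  open Poly F
  open PolyRing F
  open Division F
  open Map F K ι hom
  open SetoidReasoning K.setoid

  value : P → K.Carrier
  value a = EK.eval (ιP a) θ

  value-cong : ∀ {a b} → a ≋ b → value a K.≈ value b
  value-cong e = RK.eval-cong θ (ι-congP e)

  value-+ : ∀ a b → value (a +P b) K.≈ value a K.+ value b
  value-+ a b = K.trans (RK.eval-cong θ (ι-+ a b)) (RK.eval-+ (ιP a) (ιP b) θ)

  value-* : ∀ a b → value (a *P b) K.≈ value a K.* value b
  value-* a b = K.trans (RK.eval-cong θ (ι-* a b)) (RK.eval-* (ιP a) (ιP b) θ)

  value-· : ∀ c a → value (c ·P a) K.≈ ι c K.* value a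
  value-· c a = K.trans (RK.eval-cong θ (ι-· c a)) (RK.eval-· (ι c) (ιP a) θ)

  value-sub : ∀ a b → value (a -P b) K.≈ value a K.- value b
  value-sub a b = K.trans (RK.eval-cong θ (ι-sub a b)) (RK.eval-sub (ιP a) (ιP b) θ)

  value-oneP : value oneP K.≈ K.1#
  value-oneP = K.trans (RK.eval-cong θ ι-oneP) (RK.eval-const K.1# θ)

  value-*-zeroˡ : ∀ {a} b → value a K.≈ K.0# → value (a *P b) K.≈ K.0#
  value-*-zeroˡ {a} b e = K.trans (value-* a b) (K.trans (K.*-congʳ e) (K.zeroˡ _))

  private
    -- Pads with zeros as well as cutting off: the list representing a polynomial of degree n may be
    -- longer than needed, whereas `divModMonic` reads the degree of the divisor from the length of
    -- this list.
    truncate : ℕ → P → List F.Carrier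
    truncate zero    g       = []
    truncate (suc n) []      = F.0# ∷ truncate n []
    truncate (suc n) (c ∷ g) = c ∷ truncate n g

    length-truncate : ∀ n g → length (truncate n g) ≡ n
    length-truncate zero    g       = ≡.refl
    length-truncate (suc n) []      = cong suc (length-truncate n [])
    length-truncate (suc n) (c ∷ g) = cong suc (length-truncate n g)

    truncate-monic : ∀ n g → Monic n g → g ≋ truncate n g ++ [ F.1# ]
    truncate-monic zero g (below , one) = coefwise λ
      { zero → one ; (suc i) → below (suc i) (s≤s z≤n) }
    truncate-monic (suc n) [] (below , one) = coefwise λ
      { zero → F.refl ; (suc i) → at (truncate-monic n [] ((λ _ _ → F.refl) , one)) i }
    truncate-monic (suc n) (c ∷ g) (below , one) =
      ∷-cong F.refl (truncate-monic n g ((λ i l → below (suc i) (s≤s l)) , one))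

  -- Dividing ℘ by g leaves a remainder that vanishes at θ and so is zero by `minimal`; thus ℘ = g
  -- s. Here g is no unit because it vanishes at θ, and s is no unit because g would then be a
  -- multiple of ℘ of smaller degree, hence zero. This contradicts irreducibility.
  monic-root-impossible : ∀ n → suc n ≤ d → (∀ r → DegreeBelow n r → value r K.≈ K.0# → r ≋ []) →
                          ∀ g → Monic n g → ¬ value g K.≈ K.0#
  monic-root-impossible n n<d minimal g g-monic@(g-below , g-one) g[θ]≈0 =
    [ g-unit , s-unit ]′ (proj₂ ℘-irreducible g s (≋⇒≈P ℘≋gs))
    where
    gs = truncate n g
    s = proj₁ (divModMonic gs ℘)
    r = proj₂ (divModMonic gs ℘)
    ℘≋gs+r : ℘ ≋ g *P s +P r
    ℘≋gs+r = ≋-trans (proj₁ (divModMonic-spec gs ℘))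
      (+P-cong (*P-congʳ s (≋-sym (truncate-monic n g g-monic))) ≋-refl)
    r≋0 : r ≋ []
    r≋0 = minimal r
      (≡.subst (λ m → DegreeBelow m r)
        (≡.trans (proj₂ (divModMonic-spec gs ℘)) (length-truncate n g)) (length⇒DegreeBelow r))
      (begin
        value r                          ≈⟨ K.+-identityˡ _ ⟨
        K.0# K.+ value r                 ≈⟨ K.+-congʳ (value-*-zeroˡ {g} s g[θ]≈0) ⟨
        value (g *P s) K.+ value r       ≈⟨ value-+ (g *P s) r ⟨
        value (g *P s +P r)              ≈⟨ value-cong ℘≋gs+r ⟨
        value ℘                          ≈⟨ ℘[θ]≈0 ⟩
        K.0#                             ∎)
    ℘≋gs : ℘ ≋ g *P s
    ℘≋gs = ≋-trans ℘≋gs+r (≋-trans (+P-cong ≋-refl r≋0) (+P-identityʳ (g *P s)))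
    g-unit : ¬ IsUnitP g
    g-unit (b , gb≈1) = proj₁ K-field (begin
      K.1#             ≈⟨ value-oneP ⟨
      value oneP       ≈⟨ value-cong (≈P⇒≋ {g *P b} {oneP} gb≈1) ⟨
      value (g *P b)   ≈⟨ value-*-zeroˡ {g} b g[θ]≈0 ⟩
      K.0#             ∎)
    s-unit : ¬ IsUnitP s
    s-unit (b , sb≈1) = proj₁ F-field (F.trans (F.sym g-one) (at g≋0 n))
      where
      ℘b≋g : ℘ *P b ≋ g
      ℘b≋g = ≋-trans (*P-congʳ b ℘≋gs)
        (≋-trans (*P-assoc g s b) (≋-trans (*P-congˡ g (≈P⇒≋ {s *P b} {oneP} sb≈1)) (*P-identityʳ g)))
      b≋0 : b ≋ []
      b≋0 = monic-*-cancel ℘ (MonicList⇒Monic ℘ (MonicOfDegree⇒MonicList ℘ ℘-monic)) b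
        λ i d≤i → F.trans (at ℘b≋g i) (g-below i (ℕ.≤-trans n<d d≤i))
      g≋0 : g ≋ []
      g≋0 = ≋-trans (≋-sym ℘b≋g) (≋-trans (*P-congˡ ℘ b≋0) (*P-zeroʳ ℘))

  -- Linear independence of 1, θ, ..., θ^(d-1) over F, by induction on the degree bound: either the
  -- top coefficient vanishes and the bound drops, or g can be scaled to a monic polynomial and the
  -- previous lemma applies, with the induction hypothesis as its minimality assumption.
  root-zero : ∀ n → n ≤ d → ∀ g → DegreeBelow n g → value g K.≈ K.0# → g ≋ []
  root-zero zero    _   g below e = DegreeBelow-zero below
  root-zero (suc n) n<d g below e with coef g n FF.≟ F.0#
  ... | yes c≈0 = root-zero n (ℕ.<⇒≤ n<d) g below′ e
    where
    below′ : DegreeBelow n g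
    below′ i n≤i with ℕ.m≤n⇒m<n∨m≡n n≤i
    ... | inj₁ n<i    = below i n<i
    ... | inj₂ ≡.refl = c≈0
  ... | no  c≉0 = contradiction
    (K.trans (value-· c⁻¹ g) (K.trans (K.*-congˡ e) (K.zeroʳ _)))
    (monic-root-impossible n n<d (root-zero n (ℕ.<⇒≤ n<d)) (c⁻¹ ·P g)
      ((λ i l → F.trans (coef-· c⁻¹ g i) (F.trans (F.*-congˡ (below i l)) (F.zeroʳ _)))
      , F.trans (coef-· c⁻¹ g n) (F.trans (F.*-comm _ _) (FF.*-⁻¹ c≉0))))
    where c⁻¹ = coef g n FF.⁻¹

  -- The remainder modulo ℘ also vanishes at θ and has degree below d, so `root-zero` applies to it.
  root⇒∣ : ∀ g → value g K.≈ K.0# → ∃ λ b → g ≋ ℘ *P b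
  root⇒∣ g g[θ]≈0 = b , ≋-trans e (≋-trans (+P-cong ≋-refl r≋0) (+P-identityʳ (℘ *P b)))
    where
    b = quotMonic g ℘
    r = proj₂ (divModMonic (lowCoeffs ℘) g)
    e : g ≋ ℘ *P b +P r
    e = proj₁ (divide ℘ (MonicOfDegree⇒MonicList ℘ ℘-monic) g)
    r≋0 : r ≋ []
    r≋0 = root-zero d ℕ.≤-refl r (proj₂ (divide ℘ (MonicOfDegree⇒MonicList ℘ ℘-monic) g)) (begin
      value r                          ≈⟨ K.+-identityˡ _ ⟨
      K.0# K.+ value r                 ≈⟨ K.+-congʳ (value-*-zeroˡ {℘} b ℘[θ]≈0) ⟨
      value (℘ *P b) K.+ value r       ≈⟨ value-+ (℘ *P b) r ⟨
      value (℘ *P b +P r)              ≈⟨ value-cong e ⟨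
      value g                          ≈⟨ g[θ]≈0 ⟩
      K.0#                             ∎)

  low-degree-injective : ∀ a b → DegreeBelow d a → DegreeBelow d b → value a K.≈ value b → a ≋ b
  low-degree-injective a b below-a below-b e = -P-zero⇒≋ a b
    (root-zero d ℕ.≤-refl (a -P b) (-P-DegreeBelow a b below-a below-b)
      (K.trans (value-sub a b) (K.trans (K.+-congʳ e) (K.-‿inverseʳ _))))

-- Fermat quotients and difference quotients compared with ℘″(θ)

module WilsonCriteria
  (F K : CommutativeRing 0ℓ 0ℓ) (F-field : IsField F) (K-field : IsField K)
  {q} (SF : HasSize F q) {d} (SK : HasSize K (q ^ d))
  (ι : CommutativeRing.Carrier F → CommutativeRing.Carrier K) (hom : IsRingHom F K ι)
  (℘ : Poly.P F) (℘-monic : Poly.MonicOfDegree F ℘ d) (℘-irreducible : Poly.Irreducible F ℘)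
  (θ : CommutativeRing.Carrier K) (℘[θ]≈0 : WilsonSetup.IsRoot F K ι q d ℘ θ)
  (2∤N : ¬ 2 ∣ q ^ d)
  where

  private
    module F = CommutativeRing F
    module RF = PolyRing F
    module DF = Division F
    module PF = Poly F
    module PR = RingProperties (CommutativeRing.ring (PolyRing.polyRing K))
  open CommutativeRing K
  open RingProperties ring
  open SemiringExp semiring using () renaming (_^_ to _^ᴿ_)
  open PolyRing K
  open Derivatives K
  open Division K
  open Map F K ι hom using (ι-congP; ι-+; ι-*; ι-·; ι-sub; ι-^; ι-X; ι-oneP; ι-deriv; ι-MonicList)
  open FiniteField K K-field SK
  open MinimalPolynomial F K F-field K-field SF ι hom ℘ ℘-monic ℘-irreducible θ ℘[θ]≈0
  open WilsonSetup F K ι q d ℘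
  open RingMorphisms.IsRingHomomorphism hom using (0#-homo; 1#-homo; -‿homo)
  open HasSize SK using (enum)
  open SemigroupProperties *-commutativeSemigroup using (x∙yz≈y∙xz)
  open SemiringSum semiring using (*-distribˡ-sum; *-distribʳ-sum)
  open SemiringSolver commutativeSemiring using (solve; _:=_; _:+_; _:*_)
  open SetoidReasoning setoid

  N : ℕ
  N = q ^ d

  2≉0 : ¬ 1# + 1# ≈ 0#
  2≉0 = odd-size⇒2≉0 2∤N

  ℘₁ ℘₂ : Carrier
  ℘₁ = eval₁ ℘K θ
  ℘₂ = eval₂ ℘K θ

  -- The common form of the criteria: a condition x = 0 is compared with another one by a relation u
  -- x = v y with nonzero constants.
  zero⇔zero : ∀ {u v x y} → ¬ u ≈ 0# → ¬ v ≈ 0# → u * x ≈ v * y → x ≈ 0# ⇔ y ≈ 0#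
  zero⇔zero {u} {v} u≉0 v≉0 e = mk⇔
    (λ x≈0 → integral v≉0 (trans (sym e) (trans (*-congˡ x≈0) (zeroʳ u))))
    (λ y≈0 → integral u≉0 (trans e (trans (*-congˡ y≈0) (zeroʳ v))))

  double : ∀ x → (1# + 1#) * x ≈ x + x
  double x = trans (distribʳ x 1# 1#) (+-cong (*-identityˡ x) (*-identityˡ x))

  ℘K-monic : MonicList d ℘K
  ℘K-monic = ι-MonicList ℘ (λ 0≡len → ℕ.0≢1+n (≡.trans 0≡len (proj₁ ℘-monic)))
    (DF.MonicOfDegree⇒MonicList ℘ ℘-monic)

  eval₁-frobenius : ∀ a → eval₁ (a ^P N -P a) θ ≈ - eval₁ a θ
  eval₁-frobenius a = begin
    eval₁ (a ^P N -P a) θ               ≈⟨ eval₁-sub (a ^P N) a θ ⟩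
    eval₁ (a ^P N) θ - eval₁ a θ        ≈⟨ +-congʳ (eval-zero θ (deriv-^-char N size⨯1≈0 a)) ⟩
    0# - eval₁ a θ                      ≈⟨ +-identityˡ _ ⟩
    - eval₁ a θ                         ∎

  eval₂-frobenius : ∀ a → eval₂ (a ^P N -P a) θ ≈ - eval₂ a θ
  eval₂-frobenius a = begin
    eval₂ (a ^P N -P a) θ               ≈⟨ eval₂-sub (a ^P N) a θ ⟩
    eval₂ (a ^P N) θ - eval₂ a θ        ≈⟨ +-congʳ (eval-zero θ (deriv-zero (deriv-^-char N size⨯1≈0 a))) ⟩
    0# - eval₂ a θ                      ≈⟨ +-identityˡ _ ⟩
    - eval₂ a θ                         ∎

  eval₁-℘K* : ∀ c → eval₁ (℘K *P c) θ ≈ ℘₁ * eval c θ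
  eval₁-℘K* c = begin
    eval₁ (℘K *P c) θ                             ≈⟨ eval₁-* ℘K c θ ⟩
    ℘₁ * eval c θ + eval ℘K θ * eval₁ c θ         ≈⟨ +-congˡ (trans (*-congʳ ℘[θ]≈0) (zeroˡ _)) ⟩
    ℘₁ * eval c θ + 0#                            ≈⟨ +-identityʳ _ ⟩
    ℘₁ * eval c θ                                 ∎

  -- By `fermat` the polynomial a^N - a vanishes at θ, and its coefficients lie in F. That the
  -- cofactor comes from F as well is what later turns a value of Q(a) at θ into a congruence modulo
  -- ℘.
  frobenius∈F : ∀ a → ∃ λ b → ιP a ^P N -P ιP a ≋ ℘K *P ιP b
  frobenius∈F a = b , ≋-trans (≋-sym ι-frobenius) (≋-trans (ι-congP e) (ι-* ℘ b))
    where
    ι-frobenius : ιP (a PF.^P N PF.-P a) ≋ ιP a ^P N -P ιP a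
    ι-frobenius = ≋-trans (ι-sub (a PF.^P N) a) (+P-cong (ι-^ a N) ≋-refl)
    ∣frobenius : ∃ λ b → a PF.^P N PF.-P a RF.≋ ℘ PF.*P b
    ∣frobenius = root⇒∣ (a PF.^P N PF.-P a) (begin
      value (a PF.^P N PF.-P a)              ≈⟨ eval-cong θ ι-frobenius ⟩
      eval (ιP a ^P N -P ιP a) θ             ≈⟨ eval-sub (ιP a ^P N) (ιP a) θ ⟩
      eval (ιP a ^P N) θ - value a           ≈⟨ +-congʳ (trans (eval-^ (ιP a) N θ) (fermat (value a))) ⟩
      value a - value a                      ≈⟨ -‿inverseʳ _ ⟩
      0#                                     ∎)
    b = proj₁ ∣frobenius
    e = proj₂ ∣frobenius

  frobenius-X : ∃ λ b → X ^P N -P X ≋ ℘K *P ιP b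
  frobenius-X with frobenius∈F PF.X
  ... | b , e = b , ≋-trans (≋-sym (+P-cong (^P-cong N ι-X) (-P-cong ι-X))) e

  frobenius⇒eval-Qf : ∀ {a c} → a ^P N -P a ≋ ℘K *P c → ℘₁ * eval (Qf a) θ ≈ - eval₁ a θ
  frobenius⇒eval-Qf {a} {c} e = begin
    ℘₁ * eval (Qf a) θ         ≈⟨ *-congˡ (eval-cong θ (quotMonic-exact ℘K ℘K-monic e)) ⟩
    ℘₁ * eval c θ              ≈⟨ eval₁-℘K* c ⟨
    eval₁ (℘K *P c) θ          ≈⟨ eval₁-cong θ e ⟨
    eval₁ (a ^P N -P a) θ      ≈⟨ eval₁-frobenius a ⟩
    - eval₁ a θ                ∎

  Qf-X : ∃ λ b → Qf X ≋ ιP b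
  Qf-X with frobenius-X
  ... | b , e = b , quotMonic-exact ℘K ℘K-monic e

  Qf-ι : ∀ a → ∃ λ b → Qf (ιP a) ≋ ιP b
  Qf-ι a with frobenius∈F a
  ... | b , e = b , quotMonic-exact ℘K ℘K-monic e

  ℘₁*Qf-X≈-1 : ℘₁ * eval (Qf X) θ ≈ - 1#
  ℘₁*Qf-X≈-1 = trans (frobenius⇒eval-Qf (proj₂ frobenius-X)) (-‿cong (eval₁-X θ))

  ℘₁≉0 : ¬ ℘₁ ≈ 0#
  ℘₁≉0 = factor-nonZeroˡ (-1≉0 ∘ trans (sym ℘₁*Qf-X≈-1))

  Qf-X≉0 : ¬ eval (Qf X) θ ≈ 0#
  Qf-X≉0 = factor-nonZeroʳ (-1≉0 ∘ trans (sym ℘₁*Qf-X≈-1))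

  -- Over K a root at θ alone does not yield a multiple of ℘, whose other roots would matter too.
  -- For coefficients from F the division can be carried out over F, where ℘ is the minimal
  -- polynomial of θ, and then mapped to K.
  ∣-ι : ∀ {a b} → a ≋ ιP b → (a ≡P [] [mod ℘K ]) ⇔ eval a θ ≈ 0#
  ∣-ι {a} {b} a≋ιb = mk⇔ to from
    where
    to : a ≡P [] [mod ℘K ] → eval a θ ≈ 0#
    to (c , e) = begin
      eval a θ                    ≈⟨ eval-cong θ (≋-trans (≋-sym (+P-identityʳ a)) (≈P⇒≋ {a -P []} {℘K *P c} e)) ⟩
      eval (℘K *P c) θ            ≈⟨ eval-* ℘K c θ ⟩
      eval ℘K θ * eval c θ        ≈⟨ *-congʳ ℘[θ]≈0 ⟩
      0# * eval c θ               ≈⟨ zeroˡ _ ⟩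
      0#                          ∎
    from : eval a θ ≈ 0# → a ≡P [] [mod ℘K ]
    from e with root⇒∣ b (trans (sym (eval-cong θ a≋ιb)) e)
    ... | c , b≋℘c = ιP c , ≋⇒≈P (≋-trans (+P-identityʳ a)
      (≋-trans a≋ιb (≋-trans (ι-congP b≋℘c) (ι-* ℘ c))))

  i-ii′ : cond-i-ii′ θ ⇔ ℘₂ ≈ 0#
  i-ii′ = zero⇔zero 2℘₁≉0 (*-nonZero -1≉0 Qf-X≉0) (begin
    (1# + 1#) * ℘₁ * Q₁                         ≈⟨ trans (*-assoc _ _ _) (double (℘₁ * Q₁)) ⟩
    ℘₁ * Q₁ + ℘₁ * Q₁                           ≈⟨ +-inverseʳ-unique _ _ sum≈0 ⟩
    - (℘₂ * Q₀)                                 ≈⟨ -1*x≈-x _ ⟨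
    - 1# * (℘₂ * Q₀)                            ≈⟨ *-congˡ (*-comm _ _) ⟩
    - 1# * (Q₀ * ℘₂)                            ≈⟨ *-assoc _ _ _ ⟨
    - 1# * Q₀ * ℘₂                              ∎)
    where
    Q₀ = eval (Qf X) θ
    Q₁ = eval₁ (Qf X) θ
    2℘₁≉0 : ¬ (1# + 1#) * ℘₁ ≈ 0#
    2℘₁≉0 = *-nonZero 2≉0 ℘₁≉0
    X^N-X≋℘Q : X ^P N -P X ≋ ℘K *P Qf X
    X^N-X≋℘Q = ≋-trans (proj₂ frobenius-X) (*P-congˡ ℘K
      (≋-sym (quotMonic-exact ℘K ℘K-monic (proj₂ frobenius-X))))
    -- In the second derivative of t^N - t = ℘ Q(t) at θ, the term ℘(θ) Q″(θ) drops out, and the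
    -- left side vanishes because N = 0 in K and t″ = 0.
    sum≈0 : ℘₂ * Q₀ + (℘₁ * Q₁ + ℘₁ * Q₁) ≈ 0#
    sum≈0 = begin
      ℘₂ * Q₀ + (℘₁ * Q₁ + ℘₁ * Q₁)             ≈⟨ +-identityʳ _ ⟨
      _ + 0#                                    ≈⟨ +-congˡ (trans (*-congʳ ℘[θ]≈0) (zeroˡ _)) ⟨
      _ + eval ℘K θ * eval₂ (Qf X) θ            ≈⟨ eval₂-* ℘K (Qf X) θ ⟨
      eval₂ (℘K *P Qf X) θ                      ≈⟨ eval₂-cong θ X^N-X≋℘Q ⟨
      eval₂ (X ^P N -P X) θ                     ≈⟨ eval₂-frobenius X ⟩
      - eval₂ X θ                               ≈⟨ -‿cong (eval₂-X θ) ⟩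
      - 0#                                      ≈⟨ -0#≈0# ⟩
      0#                                        ∎

  i-ii : cond-i-ii θ ⇔ ℘₂ ≈ 0#
  i-ii = i-ii′ ⇔-∘ ∣-ι {deriv (Qf X)} {PF.deriv b} (≋-trans (deriv-cong e) (≋-sym (ι-deriv b)))
    where
    b = proj₁ Qf-X
    e = proj₂ Qf-X

  eval₁-℘′ : eval₁ ℘′ θ ≈ ℘₂
  eval₁-℘′ = eval₁-cong θ (ι-deriv ℘)

  ii-i′ : cond-ii-i′ θ ⇔ ℘₂ ≈ 0#
  ii-i′ = zero⇔zero ℘₁≉0 -1≉0 (begin
    ℘₁ * eval (Qf ℘′) θ     ≈⟨ frobenius⇒eval-Qf (proj₂ (frobenius∈F (PF.deriv ℘))) ⟩
    - eval₁ ℘′ θ            ≈⟨ -‿cong eval₁-℘′ ⟩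
    - ℘₂                    ≈⟨ -1*x≈-x _ ⟨
    - 1# * ℘₂               ∎)

  ii-i : cond-ii-i θ ⇔ ℘₂ ≈ 0#
  ii-i = ii-i′ ⇔-∘ ∣-ι (proj₂ (Qf-ι (PF.deriv ℘)))

  i-iii : cond-i-iii θ ⇔ ℘₂ ≈ 0#
  i-iii = zero⇔zero 2≉0 1≉0
    (trans (double _) (trans (eval₁-diffQuot ℘K θ) (sym (*-identityˡ _))))

  iii-i : cond-iii-i θ ⇔ ℘₂ ≈ 0#
  iii-i = zero⇔zero 1≉0 1≉0 (*-congˡ (trans (eval-diffQuot ℘′ θ) eval₁-℘′))

  iii-ii : cond-iii-ii θ ⇔ ℘₂ ≈ 0#
  iii-ii = i-ii′ ⇔-∘ zero⇔zero 1≉0 1≉0 (*-congˡ (eval-diffQuot (Qf X) θ))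

  -- For h = ℘/(t − θ) the power h^(N−1) takes the value 1 at θ, because h(θ) = ℘′(θ) ≠ 0;
  -- hence ℘ = h (t − θ) divides h (h^(N−1) − 1).
  frobenius-diffQuot : ∃ λ c → diffQuot θ ℘K ^P N -P diffQuot θ ℘K ≋ ℘K *P c
  frobenius-diffQuot = go N ≡.refl
    where
    h = diffQuot θ ℘K
    h[θ]≉0 : ¬ eval h θ ≈ 0#
    h[θ]≉0 = ℘₁≉0 ∘ trans (sym (eval-diffQuot ℘K θ))
    -- The exponent `q ^ d` does not reduce to a successor, so it is generalised to n in order to
    -- split one factor h off the power. It is nonzero because K has an element.
    go : ∀ n → N ≡ n → ∃ λ c → h ^P n -P h ≋ ℘K *P c
    go zero    N≡0 = contradiction (≡.subst Fin N≡0 (index 0#)) Fin.¬Fin0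
    go (suc M) N≡1+M = w ,
      ≋-trans (+P-cong (≋-refl {h *P h ^P M}) (≋-trans (-P-cong (≋-sym (*P-identityʳ h))) (PR.-‿distribʳ-* h oneP)))
      (≋-trans (≋-sym (*P-distribˡ h (h ^P M) (-P oneP)))
      (≋-trans (*P-congˡ h (≋-trans (root⇒diffQuot (h ^P M -P oneP) θ h^M-1[θ]≈0) (*P-comm w (linear θ))))
      (≋-trans (≋-sym (*P-assoc h (linear θ) w))
               (*P-congʳ w (≋-sym (root⇒diffQuot ℘K θ ℘[θ]≈0))))))
      where
      w = diffQuot θ (h ^P M -P oneP)
      h^M-1[θ]≈0 : eval (h ^P M -P oneP) θ ≈ 0#
      h^M-1[θ]≈0 = begin
        eval (h ^P M -P oneP) θ          ≈⟨ eval-sub (h ^P M) oneP θ ⟩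
        eval (h ^P M) θ - eval oneP θ    ≈⟨ +-cong (eval-^ h M θ) (-‿cong (eval-const 1# θ)) ⟩
        eval h θ ^ᴿ M - 1#               ≈⟨ +-congʳ (*-cancelˡ-nonZero h[θ]≉0 (begin
          eval h θ * eval h θ ^ᴿ M         ≡⟨ cong (eval h θ ^ᴿ_) N≡1+M ⟨
          eval h θ ^ᴿ N                    ≈⟨ fermat _ ⟩
          eval h θ                         ≈⟨ *-identityʳ _ ⟨
          eval h θ * 1#                    ∎)) ⟩
        1# - 1#                          ≈⟨ -‿inverseʳ 1# ⟩
        0#                               ∎

  ii-iii : cond-ii-iii θ ⇔ ℘₂ ≈ 0#
  ii-iii = i-iii ⇔-∘ zero⇔zero ℘₁≉0 -1≉0
    (trans (frobenius⇒eval-Qf (proj₂ frobenius-diffQuot)) (sym (-1*x≈-x _)))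

  -- Value and derivative of F_d at θ

  private
    module FF = FiniteField F F-field SF
    module Fold* = Fold *-commutativeMonoid
    module Fold+ = Fold +-commutativeMonoid
  open HasSize SF using () renaming (enum to enumF; inj to injF)

  slope : PF.P → Carrier
  slope a = eval₁ (ιP a) θ

  slope-cong : ∀ {a b} → a RF.≋ b → slope a ≈ slope b
  slope-cong e = eval₁-cong θ (ι-congP e)

  slope-* : ∀ a b → slope (a PF.*P b) ≈ slope a * value b + value a * slope b
  slope-* a b = trans (eval₁-cong θ (ι-* a b)) (eval₁-* (ιP a) (ιP b) θ)

  poly : ∀ {n} → Vec (Fin q) n → PF.P
  poly v = Vec.toList (Vec.map enumF v)

  poly-degree : ∀ (v : Vec (Fin q) d) → DF.DegreeBelow d (poly v)
  poly-degree v = ≡.subst (λ m → DF.DegreeBelow m (poly v))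
    (Vec.length-toList (Vec.map enumF v)) (DF.length⇒DegreeBelow (poly v))

  poly-injective : ∀ {n} (v w : Vec (Fin q) n) → poly v RF.≋ poly w → v ≡ w
  poly-injective []      []      e = ≡.refl
  poly-injective (i ∷ v) (j ∷ w) e =
    cong₂ _∷_ (injF i j (RF.at e 0)) (poly-injective v w (RF.tail-≋ e))

  poly-value≈0 : ∀ (v : Vec (Fin q) d) → value (poly v) ≈ 0# → poly v RF.≋ []
  poly-value≈0 v = root-zero d ℕ.≤-refl (poly v) (poly-degree v)

  isZeroVec : ∀ {n} → Vec (Fin q) n → Bool
  isZeroVec v = Vec.foldr _ (λ i b → if ⌊ i Fin.≟ FF.index F.0# ⌋ then b else false) true v

  isZeroVec-reflects : ∀ {n} (v : Vec (Fin q) n) → Reflects (poly v RF.≋ []) (isZeroVec v)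
  isZeroVec-reflects []      = ofʸ RF.≋-refl
  isZeroVec-reflects (i ∷ v) with i Fin.≟ FF.index F.0#
  ... | no  i≢0 = ofⁿ λ e → i≢0 (≡.trans (≡.sym (FF.index-enum i)) (FF.index-cong (RF.at e 0)))
  ... | yes i≡0 with isZeroVec v | isZeroVec-reflects v
  ...   | true  | ofʸ v≋0 = ofʸ (RF.0∷-zero (F.trans (F.reflexive (cong enumF i≡0)) (FF.enum-index F.0#)) v≋0)
  ...   | false | ofⁿ v≋̸0 = ofⁿ (v≋̸0 ∘ RF.tail-zero)

  -- Together with `poly` and `isZeroVec` this repeats the private parts of `Fprod`, so that
  -- `productOver (allVecs q d)` is `Fprod F SF d` by computation, while an arbitrary list admits
  -- induction.
  productOver : List (Vec (Fin q) d) → PF.P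
  productOver = List.foldr (λ v acc → if isZeroVec v then acc else poly v PF.*P acc) PF.oneP

  -- The omission of the zero vector matches the value 1 of `nonZeroPart` at 0; every other factor
  -- has degree below d and therefore a nonzero value at θ.
  value-productOver : ∀ vs → value (productOver vs) ≈ Fold*.fold (nonZeroPart ∘ value ∘ poly) vs
  value-productOver []       = value-oneP
  value-productOver (v ∷ vs) with isZeroVec v | isZeroVec-reflects v
  ... | true  | ofʸ v≋0 = trans (value-productOver vs)
    (sym (trans (*-congʳ (nonZeroPart-zero (value-cong v≋0))) (*-identityˡ _)))
  ... | false | ofⁿ v≋̸0 = trans (value-* (poly v) (productOver vs))
    (*-cong (sym (nonZeroPart-nonZero (v≋̸0 ∘ poly-value≈0 v))) (value-productOver vs))

  -- The logarithmic derivative of a product. The zero vector, omitted from the product, contributes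
  -- nothing to the sum because 0⁻¹ = 0.
  slope-productOver : ∀ vs → slope (productOver vs) ≈
    value (productOver vs) * Fold+.fold (λ v → slope (poly v) * value (poly v) ⁻¹) vs
  slope-productOver []       = trans (eval₁-cong θ ι-oneP) (trans (eval-zero θ (deriv-const 1#)) (sym (zeroʳ _)))
  slope-productOver (v ∷ vs) with isZeroVec v | isZeroVec-reflects v
  ... | true  | ofʸ v≋0 = trans (slope-productOver vs)
    (*-congˡ (sym (trans (+-congʳ (trans (*-congˡ (0⁻¹ (value-cong v≋0))) (zeroʳ _))) (+-identityˡ _))))
  ... | false | ofⁿ v≋̸0 = begin
    slope (poly v PF.*P Π)                             ≈⟨ slope-* (poly v) Π ⟩
    a′ * value Π + a * slope Π                         ≈⟨ +-cong (*-comm _ _) (*-congˡ (slope-productOver vs)) ⟩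
    value Π * a′ + a * (value Π * S)                   ≈⟨ +-cong
        (sym (trans (*-congʳ (*-⁻¹ a≉0)) (*-identityˡ _))) (sym (*-assoc _ _ _)) ⟩
    a * a ⁻¹ * (value Π * a′) + a * value Π * S        ≈⟨ solve 5 (λ a b p c s →
        a :* b :* (p :* c) :+ a :* p :* s := a :* p :* (c :* b :+ s)) refl a (a ⁻¹) (value Π) a′ S ⟩
    a * value Π * (a′ * a ⁻¹ + S)                      ≈⟨ *-congʳ (value-* (poly v) Π) ⟨
    value (poly v PF.*P Π) * (a′ * a ⁻¹ + S)           ∎
    where
    Π = productOver vs
    a = value (poly v)
    a′ = slope (poly v)
    S = Fold+.fold (λ v → slope (poly v) * value (poly v) ⁻¹) vs
    a≉0 : ¬ a ≈ 0#
    a≉0 = v≋̸0 ∘ poly-value≈0 v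

  code : Vec (Fin q) d → Fin N
  code v = index (value (poly v))

  open Decode code (λ {v} {w} e → poly-injective v w
    (low-degree-injective (poly v) (poly w) (poly-degree v) (poly-degree w) (index-injective e)))

  -- The polynomial of degree < d over F with value x at θ.
  interpolant : Carrier → PF.P
  interpolant x = poly (decode (index x))

  interpolant-cong : ∀ {x y} → x ≈ y → interpolant x ≡ interpolant y
  interpolant-cong e = cong (poly ∘ decode) (index-cong e)

  interpolant-degree : ∀ x → DF.DegreeBelow d (interpolant x)
  interpolant-degree x = poly-degree (decode (index x))

  value-interpolant : ∀ x → value (interpolant x) ≈ x
  value-interpolant x = index-injective (code-decode (index x))

  value-decode : ∀ i → value (poly (decode i)) ≈ enum i
  value-decode i = index-injective (≡.trans (code-decode i) (≡.sym (index-enum i)))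

  value-Fprod : value (Fprod F SF d) ≈ - 1#
  value-Fprod = begin
    value (Fprod F SF d)                            ≈⟨ value-productOver (allVecs q d) ⟩
    Fold*.fold g (allVecs q d)                      ≈⟨ Fold*.fold-↭ g allVecs-↭ ⟩
    Fold*.fold g (List.map decode (List.allFin N))  ≡⟨ Fold*.fold-tabulate g decode {N} id ⟩
    Π.sum (g ∘ decode)                              ≈⟨ Π.sum-cong-≋ {N} (λ i → nonZeroPart-cong (value-decode i)) ⟩
    Π.sum (nonZeroPart ∘ enum)                      ≈⟨ wilson ⟩
    - 1#                                            ∎
    where
    g : Vec (Fin q) d → Carrier
    g v = nonZeroPart (value (poly v))

  logDerivative : Carrier
  logDerivative = Σ.sum (λ i → slope (interpolant (enum i)) * enum i ⁻¹)

  slope-Fprod : slope (Fprod F SF d) ≈ - 1# * logDerivative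
  slope-Fprod = begin
    slope (Fprod F SF d)                      ≈⟨ slope-productOver (allVecs q d) ⟩
    value (Fprod F SF d) * Fold+.fold g (allVecs q d)
      ≈⟨ *-cong value-Fprod (trans (Fold+.fold-↭ g allVecs-↭) (reflexive (Fold+.fold-tabulate g decode {N} id))) ⟩
    - 1# * Σ.sum (g ∘ decode)
      ≈⟨ *-congˡ (Σ.sum-cong-≋ {N} λ i → *-cong
           (reflexive (cong (slope ∘ poly ∘ decode) (≡.sym (index-enum i)))) (⁻¹-cong (value-decode i))) ⟩
    - 1# * logDerivative ∎
    where
    g : Vec (Fin q) d → Carrier
    g v = slope (poly v) * value (poly v) ⁻¹

  -- Multiplication by t on interpolants and the evaluation of S

  overflow : Carrier → Carrier
  -- This is λₓ seen in K. The coefficient of t^d in t Aₓ is that of t^(d-1) in Aₓ, written without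
  -- a predecessor of d. As a function of x it is the functional Tr(x/℘′(θ)) of Euler's formula.
  overflow x = ι (RF.coef (F.0# ∷ interpolant x) d)

  -- Both sides have the value θ x at θ, and the multiple of ℘ cancels the term of degree d.
  t*interpolant : ∀ x → F.0# ∷ interpolant x RF.≋
    interpolant (θ * x) PF.+P RF.coef (F.0# ∷ interpolant x) d PF.·P ℘
  t*interpolant x = RF.-P-zero⇒≋ a b (root-zero d ℕ.≤-refl (a PF.-P b) a-b-degree (begin
    value (a PF.-P b)        ≈⟨ value-sub a b ⟩
    value a - value b        ≈⟨ +-cong value-a (-‿cong value-b) ⟩
    θ * x - θ * x            ≈⟨ -‿inverseʳ _ ⟩
    0#                       ∎))
    where
    a = F.0# ∷ interpolant x
    λₓ = RF.coef a d
    b = interpolant (θ * x) PF.+P λₓ PF.·P ℘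
    value-a : value a ≈ θ * x
    value-a = trans (+-cong 0#-homo (*-congˡ (value-interpolant x))) (+-identityˡ _)
    value-b : value b ≈ θ * x
    value-b = begin
      value b                                        ≈⟨ value-+ (interpolant (θ * x)) (λₓ PF.·P ℘) ⟩
      value (interpolant (θ * x)) + value (λₓ PF.·P ℘)  ≈⟨ +-cong (value-interpolant _) (value-· λₓ ℘) ⟩
      θ * x + ι λₓ * value ℘                         ≈⟨ +-congˡ (trans (*-congˡ ℘[θ]≈0) (zeroʳ _)) ⟩
      θ * x + 0#                                     ≈⟨ +-identityʳ _ ⟩
      θ * x                                          ∎
    ℘-Monic : DF.Monic d ℘
    ℘-Monic = DF.MonicList⇒Monic ℘ (DF.MonicOfDegree⇒MonicList ℘ ℘-monic)
    coef-b : ∀ i → d ≤ i → RF.coef b i F.≈ λₓ F.* RF.coef ℘ i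
    coef-b i d≤i = F.trans (RF.coef-+ (interpolant (θ * x)) (λₓ PF.·P ℘) i)
      (F.trans (F.+-cong (interpolant-degree (θ * x) i d≤i) (RF.coef-· λₓ ℘ i)) (F.+-identityˡ _))
    coef-a≈b : ∀ i → d ≤ i → RF.coef a i F.≈ RF.coef b i
    coef-a≈b i d≤i with ℕ.m≤n⇒m<n∨m≡n d≤i
    ... | inj₂ ≡.refl = F.sym (F.trans (coef-b d d≤i) (F.trans (F.*-congˡ (proj₂ ℘-Monic)) (F.*-identityʳ _)))
    ... | inj₁ d<i@(s≤s d≤i-1) = F.trans (interpolant-degree x _ d≤i-1)
      (F.sym (F.trans (coef-b i d≤i) (F.trans (F.*-congˡ (proj₁ ℘-Monic i d<i)) (F.zeroʳ _))))
    a-b-degree : DF.DegreeBelow d (a PF.-P b)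
    a-b-degree i d≤i = F.trans (RF.coef-- a b i) (F.trans (F.+-congʳ (coef-a≈b i d≤i)) (F.-‿inverseʳ _))

  interpolant-0 : ∀ {x} → x ≈ 0# → interpolant x RF.≋ []
  interpolant-0 {x} e = poly-value≈0 (decode (index x)) (trans (value-interpolant x) e)

  -- For θ ≠ 0 the map x ↦ θx permutes K and 1/x = θ/(θx). The case θ = 0, which is that of ℘ = t,
  -- has no such permutation, but there f(0) = 0 makes both sides vanish.
  sum-shift : ∀ (f : Carrier → Carrier) → (∀ {x y} → x ≈ y → f x ≈ f y) → (∀ {x} → x ≈ 0# → f x ≈ 0#) →
              Σ.sum (λ i → f (θ * enum i) * enum i ⁻¹) ≈ θ * Σ.sum (λ i → f (enum i) * enum i ⁻¹)
  sum-shift f f-cong f-0 with θ ≟ 0#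
  ... | yes θ≈0 = trans
    (SumSingle.sum-ε +-commutativeMonoid (λ i → f (θ * enum i) * enum i ⁻¹)
      λ i → trans (*-congʳ (f-0 (trans (*-congʳ θ≈0) (zeroˡ _)))) (zeroˡ _))
    (sym (trans (*-congʳ θ≈0) (zeroˡ _)))
  ... | no θ≉0 = begin
    Σ.sum (λ i → f (θ * enum i) * enum i ⁻¹)
      ≈⟨ Σ.sum-cong-≋ {N} (λ i → trans (*-congˡ (sym (⁻¹-* {θ} {enum i} θ≉0)))
           (x∙yz≈y∙xz (f (θ * enum i)) θ ((θ * enum i) ⁻¹))) ⟩
    Σ.sum (λ i → θ * (f (θ * enum i) * (θ * enum i) ⁻¹))
      ≈⟨ *-distribˡ-sum θ (λ i → f (θ * enum i) * (θ * enum i) ⁻¹) ⟨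
    θ * Σ.sum (λ i → f (θ * enum i) * (θ * enum i) ⁻¹)
      ≈⟨ *-congˡ (Σ.reindex (θ *_) (θ ⁻¹ *_) *-congˡ *-congˡ (cancel (*-⁻¹ θ≉0))
           (cancel (trans (*-comm _ _) (*-⁻¹ θ≉0))) (λ x → f x * x ⁻¹) (λ e → *-cong (f-cong e) (⁻¹-cong e))) ⟨
    θ * Σ.sum (λ i → f (enum i) * enum i ⁻¹) ∎
    where
    cancel : ∀ {u v} → u * v ≈ 1# → ∀ x → u * (v * x) ≈ x
    cancel e x = trans (sym (*-assoc _ _ x)) (trans (*-congʳ e) (*-identityˡ x))

  μ : Carrier
  μ = Σ.sum (λ i → overflow (enum i) * enum i ⁻¹)

  -- The sums of b (θ x)/x and θ b x/x agree by sum-shift and cancel.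
  sum-relation : ∀ (a b : Carrier → Carrier) (c : Carrier) → (∀ {x y} → x ≈ y → b x ≈ b y) →
    (∀ {x} → x ≈ 0# → b x ≈ 0#) →
    (∀ x → a x + θ * b x ≈ b (θ * x) + overflow x * c) →
    Σ.sum (λ i → a (enum i) * enum i ⁻¹) ≈ μ * c
  sum-relation a b c b-cong b-0 rel = +-cancelʳ (θ * T b) _ _ (begin
    T a + θ * T b
      ≈⟨ +-congˡ (*-distribˡ-sum θ (λ i → b (enum i) * enum i ⁻¹)) ⟩
    T a + Σ.sum (λ i → θ * (b (enum i) * enum i ⁻¹))
      ≈⟨ Σ.∑-distrib-+ (λ i → a (enum i) * enum i ⁻¹) (λ i → θ * (b (enum i) * enum i ⁻¹)) ⟨
    Σ.sum (λ i → a (enum i) * enum i ⁻¹ + θ * (b (enum i) * enum i ⁻¹))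
      ≈⟨ Σ.sum-cong-≋ {N} (λ i → termwise (enum i)) ⟩
    Σ.sum (λ i → overflow (enum i) * enum i ⁻¹ * c + b (θ * enum i) * enum i ⁻¹)
      ≈⟨ Σ.∑-distrib-+ (λ i → overflow (enum i) * enum i ⁻¹ * c) (λ i → b (θ * enum i) * enum i ⁻¹) ⟩
    Σ.sum (λ i → overflow (enum i) * enum i ⁻¹ * c) + Σ.sum (λ i → b (θ * enum i) * enum i ⁻¹)
      ≈⟨ +-cong (sym (*-distribʳ-sum c (λ i → overflow (enum i) * enum i ⁻¹))) (sum-shift b b-cong b-0) ⟩
    μ * c + θ * T b ∎)
    where
    T : (Carrier → Carrier) → Carrier
    T f = Σ.sum (λ i → f (enum i) * enum i ⁻¹)
    termwise : ∀ x → a x * x ⁻¹ + θ * (b x * x ⁻¹) ≈ overflow x * x ⁻¹ * c + b (θ * x) * x ⁻¹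
    termwise x = begin
      a x * x ⁻¹ + θ * (b x * x ⁻¹)               ≈⟨ solve 4 (λ a t b w →
        a :* w :+ t :* (b :* w) := (a :+ t :* b) :* w) refl (a x) θ (b x) (x ⁻¹) ⟩
      (a x + θ * b x) * x ⁻¹                      ≈⟨ *-congʳ (rel x) ⟩
      (b (θ * x) + overflow x * c) * x ⁻¹         ≈⟨ solve 4 (λ b o c w →
        (b :+ o :* c) :* w := o :* w :* c :+ b :* w) refl (b (θ * x)) (overflow x) c (x ⁻¹) ⟩
      overflow x * x ⁻¹ * c + b (θ * x) * x ⁻¹    ∎

  curvature : PF.P → Carrier
  curvature a = eval₂ (ιP a) θ

  ι-t*interpolant : ∀ x → ι F.0# ∷ ιP (interpolant x) ≋ ιP (interpolant (θ * x)) +P overflow x ·P ℘K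
  ι-t*interpolant x = ≋-trans (ι-congP (t*interpolant x))
    (≋-trans (ι-+ (interpolant (θ * x)) _) (+P-cong ≋-refl (ι-· _ ℘)))

  -- In the first derivative of the relation for t Aₓ the term outside θ is Aₓ(θ) = x, so the
  -- weighted sum on the left is the sum of x/x, known from `sum-*-⁻¹`.
  μ*℘₁≈-1 : μ * ℘₁ ≈ - 1#
  μ*℘₁≈-1 = trans (sym (sum-relation (λ x → x) (slope ∘ interpolant) ℘₁
    (reflexive ∘ cong slope ∘ interpolant-cong) (λ e → slope-cong (interpolant-0 e)) relation)) sum-*-⁻¹
    where
    relation : ∀ x → x + θ * slope (interpolant x) ≈ slope (interpolant (θ * x)) + overflow x * ℘₁
    relation x = begin
      x + θ * slope (interpolant x)                         ≈⟨ +-congʳ (value-interpolant x) ⟨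
      value (interpolant x) + θ * slope (interpolant x)     ≈⟨ eval₁-∷ (ι F.0#) (ιP (interpolant x)) θ ⟨
      eval₁ (ι F.0# ∷ ιP (interpolant x)) θ                 ≈⟨ eval₁-cong θ (ι-t*interpolant x) ⟩
      eval₁ (ιP (interpolant (θ * x)) +P overflow x ·P ℘K) θ
        ≈⟨ trans (eval₁-+ (ιP (interpolant (θ * x))) (overflow x ·P ℘K) θ) (+-congˡ (eval₁-· (overflow x) ℘K θ)) ⟩
      slope (interpolant (θ * x)) + overflow x * ℘₁         ∎

  -- From (t A)″ = 2 A′ + t A″: the term outside θ is now the doubled slope, which is the source of
  -- the factor 2.
  2*logDerivative : logDerivative + logDerivative ≈ μ * ℘₂
  2*logDerivative = begin
    logDerivative + logDerivative
      ≈⟨ Σ.∑-distrib-+ (λ i → s (enum i) * enum i ⁻¹) (λ i → s (enum i) * enum i ⁻¹) ⟨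
    Σ.sum (λ i → s (enum i) * enum i ⁻¹ + s (enum i) * enum i ⁻¹)
      ≈⟨ Σ.sum-cong-≋ {N} (λ i → distribʳ (enum i ⁻¹) (s (enum i)) (s (enum i))) ⟨
    Σ.sum (λ i → (s (enum i) + s (enum i)) * enum i ⁻¹)
      ≈⟨ sum-relation (λ x → s x + s x) (curvature ∘ interpolant) ℘₂
           (reflexive ∘ cong curvature ∘ interpolant-cong) (λ e → eval₂-cong θ (ι-congP (interpolant-0 e))) relation ⟩
    μ * ℘₂ ∎
    where
    s : Carrier → Carrier
    s = slope ∘ interpolant
    relation : ∀ x → s x + s x + θ * curvature (interpolant x) ≈ curvature (interpolant (θ * x)) + overflow x * ℘₂
    relation x = begin
      s x + s x + θ * curvature (interpolant x)             ≈⟨ eval₂-∷ (ι F.0#) (ιP (interpolant x)) θ ⟨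
      eval₂ (ι F.0# ∷ ιP (interpolant x)) θ                 ≈⟨ eval₂-cong θ (ι-t*interpolant x) ⟩
      eval₂ (ιP (interpolant (θ * x)) +P overflow x ·P ℘K) θ
        ≈⟨ trans (eval₂-+ (ιP (interpolant (θ * x))) (overflow x ·P ℘K) θ) (+-congˡ (eval₂-· (overflow x) ℘K θ)) ⟩
      curvature (interpolant (θ * x)) + overflow x * ℘₂     ∎

  -- From S = 0 to the congruence modulo ℘²

  logDerivative⇔ : logDerivative ≈ 0# ⇔ ℘₂ ≈ 0#
  logDerivative⇔ = zero⇔zero 2≉0 (factor-nonZeroˡ (-1≉0 ∘ trans (sym μ*℘₁≈-1)))
    (trans (double _) 2*logDerivative)

  -- Since g = a + 1 vanishes at θ, it is ℘ u with u over F, and g′(θ) = ℘′(θ) u(θ). As ℘′(θ) ≠ 0, a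
  -- vanishing slope means that u vanishes at θ, which gives the second factor ℘.
  ≡-1mod℘²⇔slope : ∀ a → value a ≈ - 1# → (a PF.≡P PF.-P PF.oneP [mod ℘ PF.*P ℘ ]) ⇔ slope a ≈ 0#
  ≡-1mod℘²⇔slope a a[θ]≈-1 = mk⇔ to from
    where
    -1P g : PF.P
    -1P = PF.-P PF.oneP
    g = a PF.-P -1P
    slope-g : slope g ≈ slope a
    slope-g = begin
      slope g                        ≈⟨ eval₁-cong θ (ι-sub a -1P) ⟩
      eval₁ (ιP a -P ιP -1P) θ       ≈⟨ eval₁-sub (ιP a) (ιP -1P) θ ⟩
      slope a - eval₁ (ιP -1P) θ     ≈⟨ +-congˡ (trans
        (-‿cong (eval-zero θ (deriv-const (ι (F.- F.1#))))) -0#≈0#) ⟩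
      slope a + 0#                   ≈⟨ +-identityʳ (slope a) ⟩
      slope a                        ∎
    slope-℘* : ∀ u → slope (℘ PF.*P u) ≈ ℘₁ * value u
    slope-℘* u = trans (eval₁-cong θ (ι-* ℘ u)) (eval₁-℘K* (ιP u))
    value-g : value g ≈ 0#
    value-g = begin
      value g                 ≈⟨ value-sub a -1P ⟩
      value a - value -1P     ≈⟨ +-cong a[θ]≈-1 (-‿cong
        (trans (eval-const (ι (F.- F.1#)) θ) (trans (-‿homo F.1#) (-‿cong 1#-homo)))) ⟩
      - 1# - - 1#             ≈⟨ -‿inverseʳ (- 1#) ⟩
      0#                      ∎
    to : a PF.≡P -1P [mod ℘ PF.*P ℘ ] → slope a ≈ 0#
    to (c , e) = begin
      slope a                                   ≈⟨ slope-g ⟨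
      slope g                                   ≈⟨ slope-cong
        (RF.≋-trans (RF.≈P⇒≋ {g} {℘ PF.*P ℘ PF.*P c} e) (RF.*P-assoc ℘ ℘ c)) ⟩
      slope (℘ PF.*P (℘ PF.*P c))               ≈⟨ slope-℘* (℘ PF.*P c) ⟩
      ℘₁ * value (℘ PF.*P c)                    ≈⟨ *-congˡ (value-*-zeroˡ {℘} c ℘[θ]≈0) ⟩
      ℘₁ * 0#                                   ≈⟨ zeroʳ ℘₁ ⟩
      0#                                        ∎
    from : slope a ≈ 0# → a PF.≡P -1P [mod ℘ PF.*P ℘ ]
    from e = w , RF.≋⇒≈P {g} {℘ PF.*P ℘ PF.*P w} (RF.≋-trans g≋℘u
      (RF.≋-trans (RF.*P-congˡ ℘ u≋℘w) (RF.≋-sym (RF.*P-assoc ℘ ℘ w))))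
      where
      u : PF.P
      u = proj₁ (root⇒∣ g value-g)
      g≋℘u : g RF.≋ ℘ PF.*P u
      g≋℘u = proj₂ (root⇒∣ g value-g)
      ℘∣u : ∃ λ w → u RF.≋ ℘ PF.*P w
      ℘∣u = root⇒∣ u (integral ℘₁≉0 (begin
        ℘₁ * value u           ≈⟨ slope-℘* u ⟨
        slope (℘ PF.*P u)      ≈⟨ slope-cong g≋℘u ⟨
        slope g                ≈⟨ slope-g ⟩
        slope a                ≈⟨ e ⟩
        0#                     ∎))
      w : PF.P
      w = proj₁ ℘∣u
      u≋℘w : u RF.≋ ℘ PF.*P w
      u≋℘w = proj₂ ℘∣u

  wilsonPrime⇔ : IsWilsonPrime F SF ℘ d ⇔ ℘₂ ≈ 0#
  wilsonPrime⇔ = logDerivative⇔ ⇔-∘ (zero⇔zero 1≉0 -1≉0 (trans (*-identityˡ _) slope-Fprod) ⇔-∘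
    ≡-1mod℘²⇔slope (Fprod F SF d) value-Fprod)

-- Oddness of q^d and the eight equivalences

odd-^ : ∀ {m} → ¬ 2 ∣ m → ∀ n → ¬ 2 ∣ m ^ n
odd-^ 2∤m zero    2∣1 with ∣1⇒≡1 2∣1
... | ()
odd-^ {m} 2∤m (suc n) 2∣m^1+n = [ 2∤m , odd-^ 2∤m n ]′ (euclidsLemma m (m ^ n) prime[2] 2∣m^1+n)

theorem4 : (p k q d : ℕ) → Prime p → ¬ (2 ∣ p) → 1 ≤ k → q ≡ p ^ k →
    (F K : CommutativeRing 0ℓ 0ℓ) → IsField F → IsField K →
    (SF : HasSize F q) → HasSize K (q ^ d) →
    (ι : CommutativeRing.Carrier F → CommutativeRing.Carrier K) → IsRingHom F K ι →
    (℘ : Poly.P F) → Poly.MonicOfDegree F ℘ d → Poly.Irreducible F ℘ →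
    (θ : CommutativeRing.Carrier K) → WilsonSetup.IsRoot F K ι q d ℘ θ →
    (IsWilsonPrime F SF ℘ d ⇔ WilsonSetup.cond-i-ii F K ι q d ℘ θ)
    × (IsWilsonPrime F SF ℘ d ⇔ WilsonSetup.cond-i-ii′ F K ι q d ℘ θ)
    × (IsWilsonPrime F SF ℘ d ⇔ WilsonSetup.cond-ii-i F K ι q d ℘ θ)
    × (IsWilsonPrime F SF ℘ d ⇔ WilsonSetup.cond-ii-i′ F K ι q d ℘ θ)
    × (IsWilsonPrime F SF ℘ d ⇔ WilsonSetup.cond-i-iii F K ι q d ℘ θ)
    × (IsWilsonPrime F SF ℘ d ⇔ WilsonSetup.cond-iii-i F K ι q d ℘ θ)
    × (IsWilsonPrime F SF ℘ d ⇔ WilsonSetup.cond-ii-iii F K ι q d ℘ θ)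
    × (IsWilsonPrime F SF ℘ d ⇔ WilsonSetup.cond-iii-ii F K ι q d ℘ θ)
theorem4 p k q d _ 2∤p _ q≡p^k F K F-field K-field SF SK ι hom ℘ ℘-monic ℘-irreducible θ ℘[θ]≈0 =
  from i-ii , from i-ii′ , from ii-i , from ii-i′ , from i-iii , from iii-i , from ii-iii , from iii-ii
  where
  2∤N : ¬ 2 ∣ q ^ d
  2∤N = odd-^ (λ 2∣q → odd-^ 2∤p k (≡.subst (2 ∣_) q≡p^k 2∣q)) d
  open WilsonCriteria F K F-field K-field SF SK ι hom ℘ ℘-monic ℘-irreducible θ ℘[θ]≈0 2∤N
  from : ∀ {C : Set} → C ⇔ CommutativeRing._≈_ K ℘₂ (CommutativeRing.0# K) → IsWilsonPrime F SF ℘ d ⇔ C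
  from c = ⇔-sym c ⇔-∘ wilsonPrime⇔
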